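{- Let $m,n\ge 2$, $e=\gcd(m,n)$, $d=\mathrm{lcm}(m,n)$, and let $k$ be a positive integer with $\gcd(k,m)=\gcd(k,n)=1$. Let $\Omega_{m,n}$ be the $\mathbb F_q$-space of all $\mathbb F_q$-bilinear forms $f:\mathbb F_{q^m}\times\mathbb F_{q^n}\to\mathbb F_q$. For $0\le j\le e-1$ and $a\in\mathbb F_{q^d}$ let $f^{(k)}_{a,j}(x,x')=\mathrm{Tr}_{q^d/q}(a\,x\,x'^{q^{kj}})$ and $\Omega^{(k)}_j=\{f^{(k)}_{a,j}:a\in\mathbb F_{q^d}\}$. Then $$\Omega_{m,n}=\bigoplus_{j=0}^{e-1}\Omega^{(k)}_j.$$
   Context: $\mathbb F_{q^m}$ and $\mathbb F_{q^n}$ are regarded as subfields of $\mathbb F_{q^d}$, so $x\,x'^{q^{kj}}\in\mathbb F_{q^d}$; $\mathrm{Tr}_{q^d/q}(y)=\sum_{i=0}^{d-1}y^{q^i}$. (In the paper, $\mathbb F_{q^m}$ and $\mathbb F_{q^n}$ parametrize the $k$-cyclic models $\{\sum_{i}x^{q^{ki}}s^{(k)}_i\}$ of $m$- and $n$-dimensional $\mathbb F_q$-spaces, and $f^{(k)}_{a,j}$ is the bilinear form on these models expressed in the parameters $x,x'$.) -}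

module Defs where

open import Level using (0ℓ)
open import Data.Nat as ℕ using (ℕ; zero; suc)
open import Data.Fin using (Fin; zero; suc)
open import Data.Product using (_×_; Σ; ∃)
open import Relation.Binary.PropositionalEquality using (_≡_)
open import Relation.Nullary using (¬_)
open import Algebra.Structures using (IsCommutativeRing)
open import Function.Bundles using (_↔_)

record FiniteField : Set₁ where
  infixl 7 _*_
  infixl 6 _+_
  field
    Carrier : Set
    _+_ _*_ : Carrier → Carrier → Carrier
    -_      : Carrier → Carrier
    0# 1#   : Carrier
    isCommutativeRing : IsCommutativeRing _≡_ _+_ _*_ -_ 0# 1#
    0≢1     : ¬ (0# ≡ 1#)
    inv     : (x : Carrier) → ¬ (x ≡ 0#) → Carrier
    inv-r   : (x : Carrier) (nz : ¬ (x ≡ 0#)) → x * inv x nz ≡ 1#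
    size    : ℕ
    enum    : Carrier ↔ Fin size

module FieldOps (K : FiniteField) where
  open FiniteField K

  pow : Carrier → ℕ → Carrier
  pow x zero    = 1#
  pow x (suc n) = x * pow x n

  sumFin : (r : ℕ) → (Fin r → Carrier) → Carrier
  sumFin zero    g = 0#
  sumFin (suc r) g = g zero + sumFin r (λ i → g (suc i))

  module Over (q : ℕ) where
    -- membership in the subfield F_{q^r} = { x : x^(q^r) = x }
    In : ℕ → Carrier → Set
    In r x = pow x (q ℕ.^ r) ≡ x

    Tr : ℕ → Carrier → Carrier
    Tr d y = sumFin d (λ i → pow y (q ℕ.^ Data.Fin.toℕ i))

    -- f : F_{q^m} × F_{q^n} → F_q is an F_q-bilinear form.
    -- Forms are represented by K-valued functions on K × K; only their
    -- values on F_{q^m} × F_{q^n} are relevant.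
    IsBilinear : ℕ → ℕ → (Carrier → Carrier → Carrier) → Set
    IsBilinear m n f =
        (∀ x x' → In m x → In n x' → In 1 (f x x'))
      × (∀ x y x' → In m x → In m y → In n x' → f (x + y) x' ≡ f x x' + f y x')
      × (∀ c x x' → In 1 c → In m x → In n x' → f (c * x) x' ≡ c * f x x')
      × (∀ x x' y' → In m x → In n x' → In n y' → f x (x' + y') ≡ f x x' + f x y')
      × (∀ c x x' → In 1 c → In m x → In n x' → f x (c * x') ≡ c * f x x')

    FormEq : ℕ → ℕ → (Carrier → Carrier → Carrier) → (Carrier → Carrier → Carrier) → Set
    FormEq m n f g = ∀ x x' → In m x → In n x' → f x x' ≡ g x x'

    fkaj : (d k : ℕ) → Carrier → ℕ → Carrier → Carrier → Carrier
    fkaj d k a j x x' = Tr d (a * x * pow x' (q ℕ.^ (k ℕ.* j)))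

    sumForms : (d k e : ℕ) → (Fin e → Carrier) → Carrier → Carrier → Carrier
    sumForms d k e a x x' = sumFin e (λ j → fkaj d k (a j) (Data.Fin.toℕ j) x x')

{-# OPTIONS --safe #-}

-- Write F for the Frobenius map x ↦ x^q. For every r dividing d there are finite families
-- β, b in F_{q^r} with Σᵢ bᵢ Fᵘ(βᵢ) = 1 if u = 0 and 0 if 0 < u < r: the evaluations at points
-- form a group algebra on which every Fᵘ is multiplicative, and if γ is moved by Fᵘ then the
-- element (ev_γ − Fᵘ(γ) ev_1) / (γ − Fᵘ(γ)) takes the value 1 at F⁰ and 0 at Fᵘ; multiply over u.
-- Such families for r = m and r = n replace dual bases of the trace forms. Since k is prime to
-- e, the map (j, t) ↦ (t mod m, t + k j mod n) is a bijection from e × d to m × n. Hence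
-- pairing Σⱼ f_{aⱼ,j} with the families reads off each aⱼ, and expanding a bilinear form f
-- in the families writes it through products Tr(y) Tr(z) = Σⱼ Tr(y F^{kj}(z)).
module Submission where

open import Defs
open import Algebra.Bundles using (CommutativeMonoid; CommutativeRing)
open import Data.Fin using (Fin; zero; suc; toℕ; fromℕ; fromℕ<; inject≤; combine; remQuot; punchOut; _↑ˡ_; _↑ʳ_)
open import Data.Fin.Permutation using (Permutation; permutation)
open import Data.Fin.Properties as Finₚ using
  ( any?; toℕ<n; toℕ-fromℕ; toℕ-fromℕ<; toℕ-injective; inject≤-injective; injective⇒≤
  ; punchOut-injective; remQuot-combine; combine-remQuot; combine-injective)
import Data.Nat as Nat
open import Data.Nat using
  ( ℕ; zero; suc; _≤_; _<_; _^_; _*_; _∸_; _%_; _/_; _!; ∣_-_∣; z≤n; s≤s; z<s; s<s; NonZero; >-nonZero)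
open import Data.Nat.Combinatorics using (_C_; nCn≡1)
open import Data.Nat.Coprimality using (Coprime)
open import Data.Nat.Divisibility using (_∣_; divides)
open import Data.Nat.DivMod using (m%n<n)
open import Data.Nat.GCD using (gcd)
open import Data.Nat.LCM using (lcm; gcd*lcm; m∣lcm[m,n]; n∣lcm[m,n])
open import Data.Nat.Primality using (Prime; prime⇒nonTrivial)
import Data.Nat.Properties as ℕₚ
open import Data.Product using (_×_; Σ; _,_; ∃₂; proj₁; proj₂; uncurry)
open import Data.Sum using (_⊎_; inj₁; inj₂)
open import Function using (_∘_)
open import Function.Bundles using (Inverse)
open import Function.Definitions using (Injective)
open import Level using (0ℓ)
open import Relation.Binary.PropositionalEquality hiding (setoid)
open import Relation.Nullary using (¬_; Dec; contradiction; yes; no)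
open import Relation.Nullary.Decidable using (map′; ¬?; decidable-stable)

-- No dimension is counted and no basis of a subfield is chosen: spanning is an explicit formula for
-- the coefficients, uniqueness an explicit formula that recovers them. The families may be much
-- larger than r, since only their values at the powers of F are ever used. The obstacle is to find
-- elements moved by Fᵘ. `K` is given merely as a field with q^d elements, so for r = d they come
-- from counting the roots of X^(q^u) - X.

-- Prime divisibility of binomials, congruences, and the index map.

module Arithmetic where
  open import Data.Nat using (_+_)
  open import Data.Nat.Properties
  open import Data.Nat.Divisibility
  open import Data.Nat.DivMod using (m≡m%n+[m/n]*n; m/n*n≡m)
  open import Data.Nat.GCD using (gcd[m,n]∣m; gcd[m,n]∣n)
  open import Data.Nat.LCM using (lcm-least)
  open import Data.Nat.Coprimality using (coprime-divisor)
  open import Data.Nat.Primality using (euclidsLemma)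
  open import Data.Nat.Combinatorics using (_C_; nCk≡n!/k![n-k]!; k![n∸k]!∣n!)
  open import Data.Nat.Tactic.RingSolver using (solve-∀)

  prime∣!⇒≤ : ∀ {p} → Prime p → ∀ j → p ∣ j ! → p ≤ j
  prime∣!⇒≤ {p} pp zero    p∣1 =
    contradiction (∣1⇒≡1 p∣1) (Nat.nonTrivial⇒≢1 {p} {{prime⇒nonTrivial pp}})
  prime∣!⇒≤ pp (suc j) p∣ with euclidsLemma (suc j) (j !) pp p∣
  ... | inj₁ p∣sj = ∣⇒≤ p∣sj
  ... | inj₂ p∣j! = m≤n⇒m≤1+n (prime∣!⇒≤ pp j p∣j!)

  -- `p` divides `p !`, which is the binomial times two factorials of numbers below `p`; neither
  -- factorial can absorb the prime.
  prime∣binomial : ∀ {p k} → Prime p → 0 < k → k < p → p ∣ p C k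
  prime∣binomial {p@(suc p′)} {k} pp 0<k k<p
    with euclidsLemma (p C k) (k ! * (p ∸ k) !) pp
           (subst (p ∣_) (sym factorial) (m∣m*n (p′ !)))
    where
    instance _ = m*n≢0 (k !) ((p ∸ k) !) {{k !≢0}} {{(p ∸ k) !≢0}}
    factorial : (p C k) * (k ! * (p ∸ k) !) ≡ p !
    factorial = trans (cong (_* (k ! * (p ∸ k) !)) (nCk≡n!/k![n-k]! (<⇒≤ k<p)))
                      (m/n*n≡m (k![n∸k]!∣n! (<⇒≤ k<p)))
  ... | inj₁ p∣C = p∣C
  ... | inj₂ p∣kk with euclidsLemma (k !) ((p ∸ k) !) pp p∣kk
  ...   | inj₁ p∣k! = contradiction (prime∣!⇒≤ pp k p∣k!) (<⇒≱ k<p)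
  ...   | inj₂ p∣r! = contradiction (prime∣!⇒≤ pp (p ∸ k) p∣r!) (<⇒≱ (∸-monoʳ-< 0<k (<⇒≤ k<p)))

  -- Multiples are added on both sides, which avoids subtraction and is the shape in which a
  -- Frobenius exponent is changed on a subfield.
  Congruent : ℕ → ℕ → ℕ → Set
  Congruent m a b = ∃₂ λ x y → a + x * m ≡ b + y * m

  congruent-sym : ∀ {m a b} → Congruent m a b → Congruent m b a
  congruent-sym (x , y , eq) = y , x , sym eq

  congruent-trans : ∀ {m a b c} → Congruent m a b → Congruent m b c → Congruent m a c
  congruent-trans {m} {a} {b} {c} (x , y , p) (z , w , q) = x + z , w + y , (begin
    a + (x + z) * m       ≡⟨ split a x z m ⟩
    (a + x * m) + z * m   ≡⟨ cong (_+ z * m) p ⟩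
    (b + y * m) + z * m   ≡⟨ swap b y z m ⟩
    (b + z * m) + y * m   ≡⟨ cong (_+ y * m) q ⟩
    (c + w * m) + y * m   ≡⟨ split c w y m ⟨
    c + (w + y) * m       ∎)
    where
    open ≡-Reasoning
    split : ∀ a x z m → a + (x + z) * m ≡ (a + x * m) + z * m
    split = solve-∀
    swap : ∀ b y z m → (b + y * m) + z * m ≡ (b + z * m) + y * m
    swap = solve-∀

  congruent-+-cancel : ∀ {m a b c d} → Congruent m (a + c) (b + d) → Congruent m a b → Congruent m c d
  congruent-+-cancel {m} {a} {b} {c} {d} (x , y , p) (z , w , q) = x + w , y + z ,
    +-cancelˡ-≡ (a + z * m) _ _ (begin
      (a + z * m) + (c + (x + w) * m) ≡⟨ shuffle a z c x w m ⟩
      (a + c + x * m) + (w * m + z * m) ≡⟨ cong (_+ (w * m + z * m)) p ⟩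
      (b + d + y * m) + (w * m + z * m) ≡⟨ shuffle′ b d y w z m ⟩
      (b + w * m) + (d + (y + z) * m) ≡⟨ cong (_+ (d + (y + z) * m)) q ⟨
      (a + z * m) + (d + (y + z) * m) ∎)
    where
    open ≡-Reasoning
    shuffle : ∀ a z c x w m → (a + z * m) + (c + (x + w) * m) ≡ (a + c + x * m) + (w * m + z * m)
    shuffle = solve-∀
    shuffle′ : ∀ b d y w z m → (b + d + y * m) + (w * m + z * m) ≡ (b + w * m) + (d + (y + z) * m)
    shuffle′ = solve-∀

  congruent-% : ∀ m a .{{_ : NonZero m}} → Congruent m (a % m) a
  congruent-% m a = a / m , 0 , trans (sym (m≡m%n+[m/n]*n a m)) (sym (+-identityʳ a))

  %≡⇒congruent : ∀ {m a b} .{{_ : NonZero m}} → a % m ≡ b % m → Congruent m a b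
  %≡⇒congruent {m} {a} {b} eq = congruent-trans (congruent-sym (congruent-% m a))
    (subst (λ r → Congruent m r b) (sym eq) (congruent-% m b))

  congruent-+ˡ : ∀ {m a b} c → Congruent m a b → Congruent m (c + a) (c + b)
  congruent-+ˡ c (x , y , eq) = x , y , trans (+-assoc c _ _) (trans (cong (c +_) eq) (sym (+-assoc c _ _)))

  congruent-difference : ∀ m v w .{{_ : NonZero m}} → Σ ℕ λ u → u < m × Congruent m w (v + u)
  -- Since `m′` is -1 modulo `m`, the number `w + v * m′` stands for w - v.
  congruent-difference m@(suc m′) v w = (w + v * m′) % m , m%n<n (w + v * m′) m ,
    congruent-trans {m} {w} {v + (w + v * m′)} (v , 0 , rearrange w v m′)
      (congruent-sym {m} {v + (w + v * m′) % m} (congruent-+ˡ {m} v (congruent-% m (w + v * m′))))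
    where
    rearrange : ∀ w v m′ → w + v * suc m′ ≡ v + (w + v * m′) + 0
    rearrange = solve-∀

  congruent-∣ : ∀ {e m a b} → e ∣ m → Congruent m a b → Congruent e a b
  congruent-∣ {e} {m} {a} {b} (divides r refl) (x , y , eq) = x * r , y * r ,
    trans (cong (a +_) (*-assoc x r e)) (trans eq (cong (b +_) (sym (*-assoc y r e))))

  congruent⇒∣∸ : ∀ {m a b} → a ≤ b → Congruent m a b → m ∣ b ∸ a
  congruent⇒∣∸ {m} {a} {b} a≤b (x , y , eq) = ∣m+n∣m⇒∣n
    (subst (m ∣_) (+-cancelˡ-≡ a _ _ (trans eq (begin
       b + y * m             ≡⟨ cong (_+ y * m) (m+[n∸m]≡n a≤b) ⟨
       a + (b ∸ a) + y * m   ≡⟨ +-assoc a _ _ ⟩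
       a + (b ∸ a + y * m)   ≡⟨ cong (a +_) (+-comm (b ∸ a) _) ⟩
       a + (y * m + (b ∸ a)) ∎))) (n∣m*n x))
    (n∣m*n y)
    where open ≡-Reasoning

  congruent⇒∣ : ∀ {m a b} → Congruent m a b → m ∣ ∣ a - b ∣
  congruent⇒∣ {m} {a} {b} c with ≤-total a b
  ... | inj₁ a≤b = subst (m ∣_) (sym (m≤n⇒∣m-n∣≡n∸m a≤b)) (congruent⇒∣∸ a≤b c)
  ... | inj₂ b≤a = subst (m ∣_) (sym (m≤n⇒∣n-m∣≡n∸m b≤a)) (congruent⇒∣∸ b≤a (congruent-sym c))

  ∣∣-∣⇒≡ : ∀ {m a b} → a < m → b < m → m ∣ ∣ a - b ∣ → a ≡ b
  ∣∣-∣⇒≡ {m} {a} {b} a<m b<m m∣ with ∣ a - b ∣ in eq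
  ... | zero  = ∣m-n∣≡0⇒m≡n eq
  ... | suc r = contradiction (∣⇒≤ m∣)
    (<⇒≱ (subst (_< m) eq (≤-<-trans (∣m-n∣≤m⊔n a b) (⊔-pres-<m a<m b<m))))

  -- Modulo the gcd both congruences hold; cancelling `t` leaves k j ≡ k j′, and `k` is invertible
  -- there, so j = j′. Then t ≡ t′ modulo `m` and `n`, hence modulo the lcm, which bounds both.
  index-injective : ∀ {m n k} → Coprime k m → ∀ {j j′ t t′} →
    j < gcd m n → j′ < gcd m n → t < lcm m n → t′ < lcm m n →
    Congruent m t t′ → Congruent n (t + k * j) (t′ + k * j′) → j ≡ j′ × t ≡ t′
  index-injective {m} {n} {k} k⊥m {j} {j′} {t} {t′} j<e j′<e t<d t′<d cm cn = j≡j′ , t≡t′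
    where
    e = gcd m n
    e∣k∣j-j′∣ : e ∣ k * ∣ j - j′ ∣
    e∣k∣j-j′∣ = subst (e ∣_) (sym (*-distribˡ-∣-∣ k j j′)) (congruent⇒∣
      (congruent-+-cancel (congruent-∣ (gcd[m,n]∣n m n) cn) (congruent-∣ (gcd[m,n]∣m m n) cm)))
    e⊥k : Coprime e k
    e⊥k (i∣e , i∣k) = k⊥m (i∣k , ∣-trans i∣e (gcd[m,n]∣m m n))
    j≡j′ : j ≡ j′
    j≡j′ = ∣∣-∣⇒≡ j<e j′<e (coprime-divisor e⊥k e∣k∣j-j′∣)
    cn′ : Congruent n t t′
    cn′ = congruent-+-cancel
      (subst₂ (Congruent n) (+-comm t _) (trans (+-comm t′ _) (cong (λ i → k * i + t′) (sym j≡j′))) cn)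
      (0 , 0 , refl)
    t≡t′ : t ≡ t′
    t≡t′ = ∣∣-∣⇒≡ t<d t′<d (lcm-least (congruent⇒∣ cm) (congruent⇒∣ cn′))

-- Pigeonhole and reindexing of finite double sums.

injective⇒surjective : ∀ {n} {f : Fin n → Fin n} → Injective _≡_ _≡_ f → ∀ y → Σ (Fin n) λ x → f x ≡ y
injective⇒surjective {suc n} {f} inj y with any? (λ x → f x Finₚ.≟ y)
... | yes hit  = hit
... | no  miss = contradiction (injective⇒≤ {f = λ x → punchOut (y≢f x)} avoids-inj) ℕₚ.1+n≰n
  where
  y≢f : ∀ x → y ≢ f x
  y≢f x eq = miss (x , sym eq)
  avoids-inj : Injective _≡_ _≡_ (λ x → punchOut (y≢f x))
  avoids-inj {x} {x′} eq = inj (punchOut-injective (y≢f x) (y≢f x′) eq)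

injective⇒permutation : ∀ {n} (f : Fin n → Fin n) → Injective _≡_ _≡_ f → Permutation n n
injective⇒permutation f inj = permutation f (λ y → proj₁ (surj y)) (λ y → proj₂ (surj y))
  (λ x → inj (proj₂ (surj (f x))))
  where surj = injective⇒surjective inj

module DoubleSums {c ℓ} (M : CommutativeMonoid c ℓ) where
  open CommutativeMonoid M using (Carrier; _≈_; _∙_; ∙-cong; ∙-congˡ; setoid; assoc; identityˡ; identityʳ; ε) renaming (refl to ≈-refl; sym to ≈-sym; trans to ≈-trans; reflexive to ≈-reflexive)
  open import Algebra.Properties.CommutativeMonoid.Sum M using (sum; sum-cong-≗; sum-cong-≋; sum-permute)
  open import Relation.Binary.Reasoning.Setoid setoid

  sum-split : ∀ a b (h : Fin (a Nat.+ b) → Carrier) →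
    sum h ≈ sum (λ i → h (i ↑ˡ b)) ∙ sum (λ j → h (a ↑ʳ j))
  sum-split zero    b h = ≈-sym (identityˡ _)
  sum-split (suc a) b h = ≈-trans (∙-congˡ (sum-split a b (λ i → h (suc i)))) (≈-sym (assoc _ _ _))

  sum-combine : ∀ a b (h : Fin (a * b) → Carrier) →
    sum (λ i → sum (λ j → h (combine {a} {b} i j))) ≈ sum h
  sum-combine zero    b h = ≈-refl
  sum-combine (suc a) b h = ≈-trans
    (∙-congˡ (sum-combine a b (λ i → h (b ↑ʳ i)))) (≈-sym (sum-split b (a * b) h))

  sum-remQuot : ∀ {a b} (g : Fin a → Fin b → Carrier) →
    sum (λ i → sum (λ j → g i j)) ≈ sum (λ i → uncurry g (remQuot {a} b i))
  sum-remQuot {a} {b} g = ≈-trans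
    (sum-cong-≋ (λ i → sum-cong-≋ (λ j → ≈-reflexive (cong (uncurry g) (sym (remQuot-combine i j))))))
    (sum-combine a b (λ i → uncurry g (remQuot {a} b i)))

  -- Both rectangles are flattened to one `Fin`; as their sizes agree, injectivity of `φ` already
  -- makes it a permutation.
  sum-reindex : ∀ {a b a′ b′} → a * b ≡ a′ * b′ → (φ : Fin a × Fin b → Fin a′ × Fin b′) →
    Injective _≡_ _≡_ φ → (g : Fin a′ → Fin b′ → Carrier) →
    sum (λ i → sum (λ j → g i j)) ≈ sum (λ i → sum (λ j → uncurry g (φ (i , j))))
  sum-reindex {a} {b} {a′} {b′} size φ φ-inj g = begin
    sum (λ i → sum (λ j → g i j))
      ≈⟨ sum-remQuot g ⟩
    sum G
      ≈⟨ permuted size ⟩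
    sum (λ i → G (f i))
      ≈⟨ sum-cong-≋ (λ i → ≈-reflexive (cong (uncurry g) (uncurry remQuot-combine (φ (remQuot {a} b i))))) ⟩
    sum (λ i → uncurry g (φ (remQuot {a} b i)))
      ≈⟨ sum-remQuot (λ i j → uncurry g (φ (i , j))) ⟨
    sum (λ i → sum (λ j → uncurry g (φ (i , j)))) ∎
    where
    G : Fin (a′ * b′) → Carrier
    G i = uncurry g (remQuot {a′} b′ i)
    f : Fin (a * b) → Fin (a′ * b′)
    f i = uncurry combine (φ (remQuot {a} b i))
    remQuot-injective : Injective _≡_ _≡_ (remQuot {a} b)
    remQuot-injective {x} {y} eq = trans (sym (combine-remQuot {a} b x))
      (trans (cong (uncurry combine) eq) (combine-remQuot {a} b y))
    f-inj : Injective _≡_ _≡_ f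
    f-inj {x} {y} eq = remQuot-injective (φ-inj (let p , q = combine-injective _ _ _ _ eq in cong₂ _,_ p q))
    permuted : a * b ≡ a′ * b′ → sum G ≈ sum (λ i → G (f i))
    permuted eq = go eq G f f-inj
      where
      -- The two products become variables, so that the equality of sizes can be matched with
      -- `refl`.
      go : ∀ {r s} → r ≡ s → (G : Fin s → Carrier) (f : Fin r → Fin s) → Injective _≡_ _≡_ f → sum G ≈ sum (λ i → G (f i))
      go refl G f inj = sum-permute G (injective⇒permutation f inj)

  sum-≈ε : ∀ {n} (f : Fin n → Carrier) → (∀ i → f i ≈ ε) → sum f ≈ ε
  sum-≈ε {zero}  f z = ≈-refl
  sum-≈ε {suc n} f z = ≈-trans (∙-cong (z zero) (sum-≈ε (λ i → f (suc i)) (λ i → z (suc i)))) (identityˡ ε)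

  sum-single : ∀ {n} (i₀ : Fin n) (f : Fin n → Carrier) → (∀ i → i ≢ i₀ → f i ≈ ε) → sum f ≈ f i₀
  sum-single zero     f z = ≈-trans (∙-congˡ (sum-≈ε (λ i → f (suc i)) (λ i → z (suc i) λ ()))) (identityʳ _)
  sum-single (suc i₀) f z = ≈-trans
    (∙-cong (z zero λ ()) (sum-single i₀ (λ i → f (suc i)) (λ i i≢ → z (suc i) (λ eq → i≢ (Finₚ.suc-injective eq)))))
    (identityˡ _)

-- Finite fields: Fermat's identity, characteristic, additivity of p-th powers.

module FiniteFieldTheory (K : FiniteField) where
  open FiniteField K renaming (_*_ to _·_)
  open FieldOps K public
  open Inverse enum public using (to; from)

  commutativeRing : CommutativeRing 0ℓ 0ℓ
  commutativeRing = record { isCommutativeRing = isCommutativeRing }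

  open CommutativeRing commutativeRing public using
    ( commutativeSemiring; semiring; +-commutativeMonoid; *-commutativeMonoid; +-group; ring
    ; +-assoc; +-comm; +-identityˡ; +-identityʳ; -‿inverseˡ; -‿inverseʳ
    ; *-assoc; *-comm; *-identityˡ; *-identityʳ; zeroˡ; zeroʳ; distribˡ; distribʳ)
  open import Algebra.Properties.Group +-group public using () renaming (∙-cancelˡ to +-cancelˡ; x∙y⁻¹≈ε⇒x≈y to x-y≡0⇒x≡y)
  open import Algebra.Properties.Semiring.Sum semiring public
    using (sum; sum-cong-≗; sum-replicate; ∑-distrib-+; ∑-comm; *-distribˡ-sum; *-distribʳ-sum)
  open import Algebra.Properties.CommutativeMonoid.Sum *-commutativeMonoid public
    using () renaming (sum to product; sum-cong-≗ to product-cong-≗; sum-replicate to product-replicate; ∑-distrib-+ to product-distrib)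
  open import Algebra.Properties.Semiring.Mult semiring public using (×1-homo-*; ×-assoc-*) renaming (_×_ to _×ₖ_)
  open import Algebra.Properties.CommutativeSemiring.Exp commutativeSemiring public using (^-assocʳ; ^-distrib-*) renaming (_^_ to _^ₖ_)
  open import Algebra.Properties.CommutativeSemiring.Binomial commutativeSemiring public using (binomialTerm) renaming (theorem to binomial-theorem)
  open import Algebra.Solver.Ring.NaturalCoefficients.Default commutativeSemiring public using (solve; _:+_; _:*_; _:=_)
  open DoubleSums +-commutativeMonoid public using (sum-reindex; sum-remQuot; sum-single; sum-≈ε)
  module Product = DoubleSums *-commutativeMonoid

  open ≡-Reasoning

  from-injective : Injective _≡_ _≡_ from
  from-injective {i} {j} eq = trans (sym (Inverse.strictlyInverseˡ enum i)) (trans (cong to eq) (Inverse.strictlyInverseˡ enum j))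

  from∘to : ∀ x → from (to x) ≡ x
  from∘to = Inverse.strictlyInverseʳ enum

  infix 4 _≟_
  _≟_ : (x y : Carrier) → Dec (x ≡ y)
  x ≟ y = map′ (λ eq → trans (sym (from∘to x)) (trans (cong from eq) (from∘to y))) (cong to) (to x Finₚ.≟ to y)

  ·-zero : ∀ {x y} → x ≢ 0# → x · y ≡ 0# → y ≡ 0#
  ·-zero {x} {y} x≢0 xy≡0 = begin
    y                   ≡⟨ *-identityˡ y ⟨
    1# · y              ≡⟨ cong (_· y) (trans (*-comm _ _) (inv-r x x≢0)) ⟨
    (inv x x≢0 · x) · y ≡⟨ *-assoc _ _ _ ⟩
    inv x x≢0 · (x · y) ≡⟨ cong (inv x x≢0 ·_) xy≡0 ⟩
    inv x x≢0 · 0#      ≡⟨ zeroʳ _ ⟩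
    0#                  ∎

  ·-cancelˡ : ∀ {x y z} → x ≢ 0# → x · y ≡ x · z → y ≡ z
  ·-cancelˡ {x} {y} {z} x≢0 eq = begin
    y                   ≡⟨ strip y ⟨
    inv x x≢0 · (x · y) ≡⟨ cong (inv x x≢0 ·_) eq ⟩
    inv x x≢0 · (x · z) ≡⟨ strip z ⟩
    z                   ∎
    where
    strip : ∀ y → inv x x≢0 · (x · y) ≡ y
    strip y = trans (sym (*-assoc _ _ _))
      (trans (cong (_· y) (trans (*-comm _ _) (inv-r x x≢0))) (*-identityˡ y))

  sumFin≡sum : ∀ {r} (g : Fin r → Carrier) → sumFin r g ≡ sum g
  sumFin≡sum {zero}  g = refl
  sumFin≡sum {suc r} g = cong (g zero +_) (sumFin≡sum (g ∘ suc))

  pow≡^ : ∀ x n → pow x n ≡ x ^ₖ n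
  pow≡^ x zero    = refl
  pow≡^ x (suc n) = cong (x ·_) (pow≡^ x n)

  pow-* : ∀ x a b → pow x (a * b) ≡ pow (pow x a) b
  pow-* x a b rewrite pow≡^ (pow x a) b | pow≡^ x a | pow≡^ x (a * b) = sym (^-assocʳ x a b)

  pow-distrib-· : ∀ x y n → pow (x · y) n ≡ pow x n · pow y n
  pow-distrib-· x y n rewrite pow≡^ (x · y) n | pow≡^ x n | pow≡^ y n = ^-distrib-* x y n

  transport-injective : ∀ {σ} → Injective _≡_ _≡_ σ → Injective _≡_ _≡_ (to ∘ σ ∘ from)
  transport-injective inj eq = from-injective (inj (trans (sym (from∘to _)) (trans (cong from eq) (from∘to _))))

  module _ (M : CommutativeMonoid 0ℓ 0ℓ) where
    open CommutativeMonoid M using (_≈_) renaming (Carrier to A; reflexive to ≈-reflexive; trans to ≈-trans)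
    import Algebra.Properties.CommutativeMonoid.Sum M as S

    -- The monoid is left open because both operations of `K` need this: additively with the shift
    -- by `1#`, multiplicatively with the map `x ·_`.
    sum-over-K : ∀ (g : Carrier → A) {σ} → Injective _≡_ _≡_ σ → S.sum (g ∘ from) ≈ S.sum (g ∘ σ ∘ from)
    sum-over-K g {σ} inj = ≈-trans
      (S.sum-permute (g ∘ from) (injective⇒permutation _ (transport-injective inj)))
      (≈-reflexive (S.sum-cong-≗ (λ i → cong g (from∘to (σ (from i))))))

  -- Shifting every element by `1#` permutes `K` and so preserves the sum of all elements, while
  -- adding `size` copies of `1#` to it.
  size×≡0 : size ×ₖ 1# ≡ 0#
  size×≡0 = sym (+-cancelˡ (sum from) _ _ (begin
    sum from + 0#                        ≡⟨ +-identityʳ _ ⟩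
    sum from                             ≡⟨ sum-over-K +-commutativeMonoid (λ x → x) {_+ 1#} (λ {x} {y} eq → +-cancelˡ 1# x y (trans (+-comm 1# x) (trans eq (+-comm y 1#)))) ⟩
    sum (λ i → from i + 1#)              ≡⟨ ∑-distrib-+ from (λ _ → 1#) ⟩
    sum from + sum {size} (λ _ → 1#)     ≡⟨ cong (sum from +_) (sum-replicate size) ⟩
    sum from + size ×ₖ 1#                ∎))

  product≢0 : ∀ {n} (g : Fin n → Carrier) → (∀ i → g i ≢ 0#) → product g ≢ 0#
  product≢0 {zero}  g nz eq = 0≢1 (sym eq)
  product≢0 {suc n} g nz eq = product≢0 (g ∘ suc) (nz ∘ suc) (·-zero (nz zero) eq)

  ifZero : {A : Set} → Carrier → A → A → A
  ifZero y a b with y ≟ 0#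
  ... | yes _ = a
  ... | no  _ = b

  ifZero-0 : ∀ {A : Set} (a b : A) → ifZero 0# a b ≡ a
  ifZero-0 a b with 0# ≟ 0#
  ... | yes _   = refl
  ... | no  0≢0 = contradiction refl 0≢0

  ifZero-≢ : ∀ {A : Set} {y} (a b : A) → y ≢ 0# → ifZero y a b ≡ b
  ifZero-≢ {y = y} a b y≢0 with y ≟ 0#
  ... | yes y≡0 = contradiction y≡0 y≢0
  ... | no  _   = refl

  -- The usual argument with the product of all nonzero elements, made a product over all of `K` by
  -- giving 0 a neutral factor. The constant factor `x` is split as `χ` times `χ′`, where `χ`
  -- carries the nonzero positions and `χ′` the position 0. Multiplication by `x` permutes the
  -- nonzero elements, so `χ` contributes 1 and `χ′` contributes the one remaining `x`.
  fermat-≢0 : ∀ {x} → x ≢ 0# → pow x size ≡ x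
  fermat-≢0 {x} x≢0 = begin
    pow x size                             ≡⟨ pow≡^ x size ⟩
    x ^ₖ size                              ≡⟨ product-replicate size ⟨
    product {size} (λ _ → x)               ≡⟨ product-cong-≗ (split ∘ from) ⟨
    product (λ i → χ (from i) · χ′ (from i))                ≡⟨ product-distrib (χ ∘ from) (χ′ ∘ from) ⟩
    product (χ ∘ from) · product (χ′ ∘ from)                ≡⟨ cong₂ _·_ χ-product χ′-product ⟩
    1# · x                                 ≡⟨ *-identityˡ x ⟩
    x                                      ∎
    where
    unit χ χ′ : Carrier → Carrier
    unit y = ifZero y 1# y
    χ y = ifZero y 1# x
    χ′ y = ifZero y x 1#

    split : ∀ y → χ y · χ′ y ≡ x
    split y with y ≟ 0#
    ... | yes _ = *-identityˡ x
    ... | no  _ = *-identityʳ x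

    unit≢0 : ∀ y → unit y ≢ 0#
    unit≢0 y eq with y ≟ 0#
    ... | yes _   = 0≢1 (sym eq)
    ... | no  y≢0 = y≢0 eq

    unit-· : ∀ y → unit (x · y) ≡ unit y · χ y
    unit-· y with y ≟ 0#
    ... | yes refl = trans (cong unit (zeroʳ x)) (trans (ifZero-0 1# 0#) (sym (*-identityˡ 1#)))
    ... | no  y≢0  = trans (ifZero-≢ 1# (x · y) (y≢0 ∘ ·-zero x≢0)) (*-comm x y)

    χ-product : product (χ ∘ from) ≡ 1#
    χ-product = ·-cancelˡ (product≢0 (unit ∘ from) (unit≢0 ∘ from)) (begin
      product (unit ∘ from) · product (χ ∘ from)      ≡⟨ product-distrib (unit ∘ from) (χ ∘ from) ⟨
      product (λ i → unit (from i) · χ (from i))      ≡⟨ product-cong-≗ (unit-· ∘ from) ⟨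
      product (λ i → unit (x · from i))               ≡⟨ sum-over-K *-commutativeMonoid unit {x ·_} (·-cancelˡ x≢0) ⟨
      product (unit ∘ from)                           ≡⟨ *-identityʳ _ ⟨
      product (unit ∘ from) · 1#                      ∎)

    χ′-product : product (χ′ ∘ from) ≡ x
    χ′-product = begin
      product (χ′ ∘ from) ≡⟨ Product.sum-single (to 0#) (χ′ ∘ from) (λ i i≢ → ifZero-≢ x 1# (λ eq → i≢ (from-injective (trans eq (sym (from∘to 0#)))))) ⟩
      χ′ (from (to 0#))   ≡⟨ cong χ′ (from∘to 0#) ⟩
      χ′ 0#               ≡⟨ ifZero-0 x 1# ⟩
      x                   ∎

  pow-0 : ∀ n → 0 < n → pow 0# n ≡ 0#
  pow-0 (suc n) _ = zeroˡ _

  fermat : ∀ x → pow x size ≡ x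
  fermat x with x ≟ 0#
  ... | no  x≢0  = fermat-≢0 x≢0
  ... | yes refl = pow-0 size (ℕₚ.≤-<-trans z≤n (toℕ<n (to 0#)))

  -- The multiple p^N of `1#` vanishes; if the multiple p did not, it could be cancelled factor by
  -- factor until `1#` itself were 0.
  char≡0 : ∀ p N → size ≡ p ^ N → p ×ₖ 1# ≡ 0#
  char≡0 p N size≡ = go N (subst (λ n → n ×ₖ 1# ≡ 0#) size≡ size×≡0)
    where
    go : ∀ N → (p ^ N) ×ₖ 1# ≡ 0# → p ×ₖ 1# ≡ 0#
    go zero    eq = contradiction (sym (trans (sym (+-identityʳ 1#)) eq)) 0≢1
    go (suc N) eq with p ×ₖ 1# ≟ 0#
    ... | yes p≡0 = p≡0
    ... | no  p≢0 = go N (·-zero p≢0 (trans (sym (×1-homo-* p (p ^ N))) eq))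

  multiple×≡0 : ∀ {p n} → p ×ₖ 1# ≡ 0# → p ∣ n → ∀ z → n ×ₖ z ≡ 0#
  multiple×≡0 {p} {n} char (divides r refl) z = begin
    (r * p) ×ₖ z          ≡⟨ cong ((r * p) ×ₖ_) (*-identityˡ z) ⟨
    (r * p) ×ₖ (1# · z)   ≡⟨ ×-assoc-* (r * p) 1# z ⟨
    ((r * p) ×ₖ 1#) · z   ≡⟨ cong (_· z) (trans (×1-homo-* r p) (trans (cong (r ×ₖ 1# ·_) char) (zeroʳ _))) ⟩
    0# · z                ≡⟨ zeroˡ z ⟩
    0#                    ∎

  pow-prime-+ : ∀ {p} → Prime p → p ×ₖ 1# ≡ 0# → ∀ x y → pow (x + y) p ≡ pow x p + pow y p
  pow-prime-+ {suc p′} pp char x y = begin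
    pow (x + y) p                              ≡⟨ pow≡^ (x + y) p ⟩
    (x + y) ^ₖ p                               ≡⟨ binomial-theorem p x y ⟩
    term zero + sum (term ∘ suc)               ≡⟨ cong₂ _+_ first (sum-single (fromℕ p′) (term ∘ suc) middle) ⟩
    y ^ₖ p + term (fromℕ p)                    ≡⟨ cong (y ^ₖ p +_) last ⟩
    y ^ₖ p + x ^ₖ p                            ≡⟨ +-comm _ _ ⟩
    x ^ₖ p + y ^ₖ p                            ≡⟨ cong₂ _+_ (pow≡^ x p) (pow≡^ y p) ⟨
    pow x p + pow y p                          ∎
    where
    p = suc p′
    term : Fin (suc p) → Carrier
    term = binomialTerm x y p

    first : term zero ≡ y ^ₖ p
    first = trans (+-identityʳ _) (*-identityˡ _)

    last : term (fromℕ p) ≡ x ^ₖ p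
    last rewrite toℕ-fromℕ p′ | nCn≡1 p | ℕₚ.n∸n≡0 p′ = trans (+-identityʳ _) (*-identityʳ _)

    middle : ∀ i → i ≢ fromℕ p′ → term (suc i) ≡ 0#
    middle i i≢last = multiple×≡0 char (Arithmetic.prime∣binomial pp z<s (s<s (ℕₚ.≤∧≢⇒< (ℕₚ.≤-pred (toℕ<n i))
      (λ eq → i≢last (toℕ-injective (trans eq (sym (toℕ-fromℕ p′)))))))) _

  pow-prime-power-+ : ∀ {p} → Prime p → p ×ₖ 1# ≡ 0# → ∀ r x y → pow (x + y) (p ^ r) ≡ pow x (p ^ r) + pow y (p ^ r)
  pow-prime-power-+ pp char zero    x y = trans (*-identityʳ _) (sym (cong₂ _+_ (*-identityʳ x) (*-identityʳ y)))
  pow-prime-power-+ {p} pp char (suc r) x y = begin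
    pow (x + y) (p * p ^ r)                           ≡⟨ pow-* (x + y) p (p ^ r) ⟩
    pow (pow (x + y) p) (p ^ r)                       ≡⟨ cong (λ z → pow z (p ^ r)) (pow-prime-+ pp char x y) ⟩
    pow (pow x p + pow y p) (p ^ r)                   ≡⟨ pow-prime-power-+ pp char r _ _ ⟩
    pow (pow x p) (p ^ r) + pow (pow y p) (p ^ r)     ≡⟨ cong₂ _+_ (pow-* x p (p ^ r)) (pow-* y p (p ^ r)) ⟨
    pow x (p * p ^ r) + pow y (p * p ^ r)             ∎

  -- Monic polynomial functions and their roots.

  -- Horner form, with the degree as index; synthetic division by x - a is then a recursion on the
  -- derivation.
  data Monic : ℕ → (Carrier → Carrier) → Set where
    one  : ∀ {f} → (∀ x → f x ≡ 1#) → Monic 0 f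
    step : ∀ {n f g} c → Monic n g → (∀ x → f x ≡ x · g x + c) → Monic (suc n) f

  monic-quotient : ∀ {n f} → Monic (suc n) f → ∀ a → Σ (Carrier → Carrier) λ h →
    Monic n h × (∀ x → f x ≡ (x + - a) · h x + f a)
  monic-quotient {f = f} (step {g = g} c (one g≡1) f≡) a = (λ _ → 1#) , one (λ _ → refl) , λ x → begin
    f x                                ≡⟨ trans (f≡ x) (cong (λ z → x · z + c) (g≡1 x)) ⟩
    -- The regrouping is a semiring identity with `- a` as an atom, so the zero `- a + a` is
    -- inserted by hand.
    x · 1# + c                         ≡⟨ cong (λ z → z · 1# + c) (trans (cong (x +_) (-‿inverseˡ a)) (+-identityʳ x)) ⟨
    (x + (- a + a)) · 1# + c           ≡⟨ solve 5 (λ x a b c o → (x :+ (b :+ a)) :* o :+ c := (x :+ b) :* o :+ (a :* o :+ c)) refl x a (- a) c 1# ⟩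
    (x + - a) · 1# + (a · 1# + c)      ≡⟨ cong ((x + - a) · 1# +_) (trans (f≡ a) (cong (λ z → a · z + c) (g≡1 a))) ⟨
    (x + - a) · 1# + f a               ∎
  monic-quotient {f = f} (step {g = g} c mg@(step _ _ _) f≡) a with monic-quotient mg a
  ... | h , mh , g≡ = (λ x → x · h x + g a) , step (g a) mh (λ _ → refl) , λ x → begin
    f x                                                 ≡⟨ trans (f≡ x) (cong (λ z → x · z + c) (g≡ x)) ⟩
    x · ((x + - a) · h x + g a) + c                     ≡⟨ cong (λ z → x · ((x + - a) · h x + g a) + z) (trans (cong (_+ c) (trans (cong (_· g a) (-‿inverseˡ a)) (zeroˡ _))) (+-identityˡ c)) ⟨
    x · ((x + - a) · h x + g a) + ((- a + a) · g a + c) ≡⟨ solve 6 (λ x a b c h g → x :* ((x :+ b) :* h :+ g) :+ ((b :+ a) :* g :+ c) := (x :+ b) :* (x :* h :+ g) :+ (a :* g :+ c)) refl x a (- a) c (h x) (g a) ⟩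
    (x + - a) · (x · h x + g a) + (a · g a + c)         ≡⟨ cong ((x + - a) · (x · h x + g a) +_) (f≡ a) ⟨
    (x + - a) · (x · h x + g a) + f a                   ∎

  monic-roots : ∀ {n f} → Monic n f → (r : Fin (suc n) → Carrier) → Injective _≡_ _≡_ r → ¬ (∀ i → f (r i) ≡ 0#)
  monic-roots (one f≡1) r inj roots = 0≢1 (trans (sym (roots zero)) (f≡1 (r zero)))
  monic-roots {f = f} mf@(step _ _ _) r inj roots with monic-quotient mf (r zero)
  ... | h , mh , f≡ = monic-roots mh (r ∘ suc) (λ eq → Finₚ.suc-injective (inj eq)) λ i →
    ·-zero (λ eq → Finₚ.0≢1+n (sym (inj (x-y≡0⇒x≡y _ _ eq)))) (begin
      (r (suc i) + - r zero) · h (r (suc i))                ≡⟨ +-identityʳ _ ⟨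
      (r (suc i) + - r zero) · h (r (suc i)) + 0#           ≡⟨ cong (_ +_) (roots zero) ⟨
      (r (suc i) + - r zero) · h (r (suc i)) + f (r zero)   ≡⟨ f≡ (r (suc i)) ⟨
      f (r (suc i))                                         ≡⟨ roots (suc i) ⟩
      0#                                                    ∎)

  monic-pow : ∀ n → Monic n (λ x → pow x n)
  monic-pow zero    = one (λ _ → refl)
  monic-pow (suc n) = step 0# (monic-pow n) (λ x → sym (+-identityʳ _))

  monic-pow-x : ∀ n → Monic (suc (suc n)) (λ x → pow x (suc (suc n)) + - x)
  monic-pow-x n = step 0# (step (- 1#) (monic-pow n) (λ _ → refl)) λ x → sym (begin
    x · (x · pow x n + - 1#) + 0#     ≡⟨ +-identityʳ _ ⟩
    x · (x · pow x n + - 1#)          ≡⟨ distribˡ x _ _ ⟩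
    x · (x · pow x n) + x · - 1#      ≡⟨ cong (x · (x · pow x n) +_) (trans (sym (-‿distribʳ-* x 1#)) (cong -_ (*-identityʳ x))) ⟩
    x · (x · pow x n) + - x           ∎)
    where open import Algebra.Properties.Ring ring using (-‿distribʳ-*)

  -- X^N - X is monic of degree N because N ≥ 2, so it cannot vanish at the first N + 1 elements of
  -- the enumeration.
  nonfixed : ∀ {N} → 2 ≤ N → N < size → Σ Carrier λ y → pow y N ≢ y
  nonfixed {N@(suc (suc n))} (s≤s (s≤s _)) N<size with any? (λ i → ¬? (pow (from i) N ≟ from i))
  ... | yes (i , nf) = from i , nf
  ... | no  none     = contradiction
    (λ i → trans (cong (_+ - r i) (decidable-stable (pow (r i) N ≟ r i) (λ nf → none (inject≤ i N<size , nf)))) (-‿inverseʳ (r i)))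
    (monic-roots (monic-pow-x n) r (λ eq → inject≤-injective N<size N<size _ _ (from-injective eq)))
    where
    r : Fin (suc N) → Carrier
    r i = from (inject≤ i N<size)

open Arithmetic

-- Frobenius powers, subfields and traces.

module Frobenius (K : FiniteField) (p s d : ℕ) (p-prime : Prime p) (1≤s : 1 ≤ s)
                 (size≡ : FiniteField.size K ≡ (p ^ s) ^ d) where
  open FiniteField K renaming (_*_ to _·_)
  open FiniteFieldTheory K
  open ≡-Reasoning

  q : ℕ
  q = p ^ s

  open Over q

  2≤q : 2 ≤ q
  2≤q = ℕₚ.≤-trans 2≤p (subst (_≤ q) (ℕₚ.^-identityʳ p) (ℕₚ.^-monoʳ-≤ p {{Nat.>-nonZero (ℕₚ.≤-trans z<s 2≤p)}} 1≤s))
    where 2≤p = Nat.nonTrivial⇒n>1 p {{prime⇒nonTrivial p-prime}}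

  instance
    q-nonZero : NonZero q
    q-nonZero = >-nonZero (ℕₚ.≤-trans z<s 2≤q)

  F : ℕ → Carrier → Carrier
  F i x = pow x (q ^ i)

  F-0 : ∀ x → F 0 x ≡ x
  F-0 = *-identityʳ

  F-∘ : ∀ i j x → F i (F j x) ≡ F (i Nat.+ j) x
  F-∘ i j x = begin
    pow (pow x (q ^ j)) (q ^ i) ≡⟨ pow-* x (q ^ j) (q ^ i) ⟨
    pow x (q ^ j * q ^ i)       ≡⟨ cong (pow x) (trans (ℕₚ.*-comm (q ^ j) _) (sym (ℕₚ.^-distribˡ-+-* q i j))) ⟩
    pow x (q ^ (i Nat.+ j))     ∎

  F-· : ∀ i x y → F i (x · y) ≡ F i x · F i y
  F-· i x y = pow-distrib-· x y (q ^ i)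

  F-+ : ∀ i x y → F i (x + y) ≡ F i x + F i y
  F-+ i x y = subst (λ N → pow (x + y) N ≡ pow x N + pow y N) (sym (ℕₚ.^-*-assoc p s i))
    (pow-prime-power-+ p-prime (char≡0 p (s * d) (trans size≡ (ℕₚ.^-*-assoc p s d))) (s * i) x y)

  F-0# : ∀ i → F i 0# ≡ 0#
  F-0# i = pow-0 (q ^ i) (ℕₚ.m^n>0 q i)

  F-1# : ∀ i → F i 1# ≡ 1#
  F-1# i = pow-1 (q ^ i)
    where
    pow-1 : ∀ n → pow 1# n ≡ 1#
    pow-1 zero    = refl
    pow-1 (suc n) = trans (*-identityˡ _) (pow-1 n)

  F-neg : ∀ i x → F i (- x) ≡ - F i x
  F-neg i x = +-cancelˡ (F i x) _ _ (trans (sym (F-+ i x (- x)))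
    (trans (cong (F i) (-‿inverseʳ x)) (trans (F-0# i) (sym (-‿inverseʳ (F i x))))))

  F-full : ∀ x → F d x ≡ x
  F-full x = subst (λ N → pow x N ≡ x) size≡ (fermat x)

  F-multiple : ∀ {r x} c → In r x → F (c * r) x ≡ x
  F-multiple         zero    _  = F-0 _
  F-multiple {r} {x} (suc c) x∈ = trans (sym (F-∘ r (c * r) x)) (trans (cong (F r) (F-multiple c x∈)) x∈)

  F-congruent : ∀ {r x a b} → In r x → Congruent r a b → F a x ≡ F b x
  F-congruent {r} {x} {a} {b} x∈ (c , c′ , eq) = begin
    F a x                   ≡⟨ cong (F a) (F-multiple c x∈) ⟨
    F a (F (c * r) x)       ≡⟨ F-∘ a (c * r) x ⟩
    F (a Nat.+ c * r) x     ≡⟨ cong (λ i → F i x) eq ⟩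
    F (b Nat.+ c′ * r) x    ≡⟨ F-∘ b (c′ * r) x ⟨
    F b (F (c′ * r) x)      ≡⟨ cong (F b) (F-multiple c′ x∈) ⟩
    F b x                   ∎

  In-+ : ∀ r {x y} → In r x → In r y → In r (x + y)
  In-+ r x∈ y∈ = trans (F-+ r _ _) (cong₂ _+_ x∈ y∈)

  In-· : ∀ r {x y} → In r x → In r y → In r (x · y)
  In-· r x∈ y∈ = trans (F-· r _ _) (cong₂ _·_ x∈ y∈)

  In-neg : ∀ r {x} → In r x → In r (- x)
  In-neg r x∈ = trans (F-neg r _) (cong -_ x∈)

  In-inv : ∀ r {x} (x≢0 : x ≢ 0#) → In r x → In r (inv x x≢0)
  In-inv r {x} x≢0 x∈ = ·-cancelˡ x≢0 (begin
    x · F r (inv x x≢0)       ≡⟨ cong (_· F r (inv x x≢0)) x∈ ⟨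
    F r x · F r (inv x x≢0)   ≡⟨ F-· r x _ ⟨
    F r (x · inv x x≢0)       ≡⟨ cong (F r) (inv-r x x≢0) ⟩
    F r 1#                    ≡⟨ F-1# r ⟩
    1#                        ≡⟨ inv-r x x≢0 ⟨
    x · inv x x≢0             ∎)

  In-F : ∀ r {x} i → In r x → In r (F i x)
  In-F r {x} i x∈ = trans (F-∘ r i x) (trans (cong (λ j → F j x) (ℕₚ.+-comm r i)) (trans (sym (F-∘ i r x)) (cong (F i) x∈)))

  In-sum : ∀ r {n} (g : Fin n → Carrier) → (∀ i → In r (g i)) → In r (sum g)
  In-sum r {zero}  g g∈ = F-0# r
  In-sum r {suc n} g g∈ = In-+ r (g∈ zero) (In-sum r (g ∘ suc) (g∈ ∘ suc))

  -- Additivity is asked only on F_{q^r}, since a bilinear form is constrained only there. The empty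
  -- sum works because φ(0) + φ(0) = φ(0) can be cancelled.
  additive-sum : ∀ r (φ : Carrier → Carrier) → (∀ x y → In r x → In r y → φ (x + y) ≡ φ x + φ y) →
    ∀ {n} (g : Fin n → Carrier) → (∀ i → In r (g i)) → φ (sum g) ≡ sum (φ ∘ g)
  additive-sum r φ φ-+ {zero}  g g∈ = +-cancelˡ (φ 0#) _ _
    (trans (sym (φ-+ 0# 0# (F-0# r) (F-0# r))) (trans (cong φ (+-identityʳ 0#)) (sym (+-identityʳ _))))
  additive-sum r φ φ-+ {suc n} g g∈ = trans (φ-+ _ _ (g∈ zero) (In-sum r (g ∘ suc) (g∈ ∘ suc)))
    (cong (φ (g zero) +_) (additive-sum r φ φ-+ (g ∘ suc) (g∈ ∘ suc)))

  F-sum : ∀ i {n} (g : Fin n → Carrier) → F i (sum g) ≡ sum (F i ∘ g)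
  F-sum i g = additive-sum d (F i) (λ x y _ _ → F-+ i x y) g (λ _ → F-full _)

  sum-shift : ∀ h (g : ℕ → Carrier) → g h ≡ g 0 → sum {h} (g ∘ suc ∘ toℕ) ≡ sum {h} (g ∘ toℕ)
  sum-shift h g gh≡g0 = +-cancelˡ (g 0) _ _ (begin
    g 0 + sum {h} (g ∘ suc ∘ toℕ)  ≡⟨ telescope h g ⟩
    sum {h} (g ∘ toℕ) + g h        ≡⟨ trans (cong (sum {h} (g ∘ toℕ) +_) gh≡g0) (+-comm _ _) ⟩
    g 0 + sum {h} (g ∘ toℕ)        ∎)
    where
    telescope : ∀ h (g : ℕ → Carrier) → g 0 + sum {h} (g ∘ suc ∘ toℕ) ≡ sum {h} (g ∘ toℕ) + g h
    telescope zero    g = +-comm _ _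
    telescope (suc h) g = trans (cong (g 0 +_) (telescope h (g ∘ suc))) (sym (+-assoc _ _ _))

  -- On F_{q^{hm}} this is the relative trace to F_{q^m}.
  partialTrace : ℕ → ℕ → Carrier → Carrier
  partialTrace h m y = sum {h} (λ i → F (toℕ i * m) y)

  In-partialTrace : ∀ h m y → In (h * m) y → In m (partialTrace h m y)
  In-partialTrace h m y y∈ = begin
    F m (partialTrace h m y)                ≡⟨ F-sum m {h} _ ⟩
    sum {h} (λ i → F m (F (toℕ i * m) y))   ≡⟨ sum-cong-≗ {h} (λ i → F-∘ m (toℕ i * m) y) ⟩
    sum {h} (λ i → F (suc (toℕ i) * m) y)   ≡⟨ sum-shift h (λ i → F (i * m) y) (trans y∈ (sym (F-0 y))) ⟩
    partialTrace h m y                      ∎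

  trace : ℕ → Carrier → Carrier
  trace r y = sum {r} (λ i → F (toℕ i) y)

  trace-∈ : ∀ {r y} → In r y → In 1 (trace r y)
  trace-∈ {r} {y} y∈ = subst (In 1) (sum-cong-≗ {r} (λ i → cong (λ j → F j y) (ℕₚ.*-identityʳ (toℕ i))))
    (In-partialTrace r 1 y (subst (λ j → F j y ≡ y) (sym (ℕₚ.*-identityʳ r)) y∈))

  Tr≡trace : ∀ y → Tr d y ≡ trace d y
  Tr≡trace y = sumFin≡sum {d} _

  trace-+ : ∀ r y z → trace r (y + z) ≡ trace r y + trace r z
  trace-+ r y z = trans (sum-cong-≗ {r} (λ i → F-+ (toℕ i) y z)) (∑-distrib-+ {r} _ _)

  F-scalar : ∀ {c} → In 1 c → ∀ i → F i c ≡ c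
  F-scalar {c} c∈ i = subst (λ j → F j c ≡ c) (ℕₚ.*-identityʳ i) (F-multiple i c∈)

  trace-scale : ∀ r {c} y → In 1 c → trace r (c · y) ≡ c · trace r y
  trace-scale r {c} y c∈ = trans
    (sum-cong-≗ {r} (λ i → trans (F-· (toℕ i) c y) (cong (_· F (toℕ i) y) (F-scalar c∈ (toℕ i)))))
    (sym (*-distribˡ-sum {r} c _))

  -- Families dual to the powers of Frobenius.

  evaluate : ∀ {r} (β b : Fin r → Carrier) → ℕ → Carrier
  evaluate β b u = sum (λ i → b i · F u (β i))

  -- The field F_{q^M} stays fixed while the range `N` of controlled exponents grows by one per
  -- factor. The length `r` is free: it doubles with each factor.
  record DualFamily (M N : ℕ) : Set where
    field
      {r}     : ℕ
      β b     : Fin r → Carrier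
      β∈      : ∀ i → In M (β i)
      b∈      : ∀ i → In M (b i)
      dual-0  : evaluate β b 0 ≡ 1#
      dual-≢0 : ∀ {u} → 0 < u → u < N → evaluate β b u ≡ 0#

  module _ {r} (β b : Fin r → Carrier) (γ δ ε : Carrier) where
    -- Points and coefficients of the product with δ ev_γ + ε ev_1, where evaluations multiply as
    -- ev_β ev_γ = ev_{βγ}.
    twistedβ twistedb : Fin 2 → Fin r → Carrier
    twistedβ zero    i = β i · γ
    twistedβ (suc _) i = β i
    twistedb zero    i = b i · δ
    twistedb (suc _) i = b i · ε

    twist-evaluate : ∀ u → evaluate (uncurry twistedβ ∘ remQuot {2} r) (uncurry twistedb ∘ remQuot {2} r) u
                         ≡ evaluate β b u · (δ · F u γ + ε)
    twist-evaluate u = begin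
      evaluate (uncurry twistedβ ∘ remQuot {2} r) (uncurry twistedb ∘ remQuot {2} r) u
        ≡⟨ sum-remQuot (λ s i → twistedb s i · F u (twistedβ s i)) ⟨
      sum (λ i → b i · δ · F u (β i · γ)) + (sum (λ i → b i · ε · F u (β i)) + 0#)
        ≡⟨ cong₂ _+_ (sum-cong-≗ (λ i → trans (cong (b i · δ ·_) (F-· u (β i) γ))
             (solve 4 (λ b δ y z → b :* δ :* (y :* z) := b :* y :* (δ :* z)) refl (b i) δ (F u (β i)) (F u γ))))
             (trans (+-identityʳ _) (sum-cong-≗ (λ i → solve 3 (λ b ε y → b :* ε :* y := b :* y :* ε) refl (b i) ε (F u (β i))))) ⟩
      sum (λ i → b i · F u (β i) · (δ · F u γ)) + sum (λ i → b i · F u (β i) · ε)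
        ≡⟨ cong₂ _+_ (*-distribʳ-sum (δ · F u γ) term) (*-distribʳ-sum ε term) ⟨
      evaluate β b u · (δ · F u γ) + evaluate β b u · ε
        ≡⟨ distribˡ _ _ _ ⟨
      evaluate β b u · (δ · F u γ + ε) ∎
      where
      term : Fin r → Carrier
      term i = b i · F u (β i)

  -- The new factor is controlled only at the exponents 0 and `N`; between them the old family
  -- vanishes, whatever the factor is.
  extendDual : ∀ {M N γ} → 0 < N → In M γ → F N γ ≢ γ → DualFamily M N → DualFamily M (suc N)
  extendDual {M} {N} {γ} 0<N γ∈ γ-moved family = record
    { r = 2 * r
    ; β = uncurry (twistedβ β b γ δ ε) ∘ remQuot {2} r
    ; b = uncurry (twistedb β b γ δ ε) ∘ remQuot {2} r
    ; β∈ = λ i → uncurry β∈′ (remQuot {2} r i)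
    ; b∈ = λ i → uncurry b∈′ (remQuot {2} r i)
    ; dual-0 = trans (twist-evaluate β b γ δ ε 0) (trans (cong₂ _·_ dual-0 factor-0) (*-identityˡ 1#))
    ; dual-≢0 = λ {u} 0<u u<1+N → trans (twist-evaluate β b γ δ ε u) (vanish 0<u (ℕₚ.m≤n⇒m<n∨m≡n (ℕₚ.≤-pred u<1+N)))
    }
    where
    open DualFamily family
    Δ : Carrier
    Δ = γ + - F N γ
    Δ≢0 : Δ ≢ 0#
    Δ≢0 eq = γ-moved (sym (x-y≡0⇒x≡y γ (F N γ) eq))
    δ ε : Carrier
    δ = inv Δ Δ≢0
    ε = - F N γ · δ
    δ∈ : In M δ
    δ∈ = In-inv M Δ≢0 (In-+ M γ∈ (In-neg M (In-F M N γ∈)))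
    ε∈ : In M ε
    ε∈ = In-· M (In-neg M (In-F M N γ∈)) δ∈
    β∈′ : ∀ s i → In M (twistedβ β b γ δ ε s i)
    β∈′ zero    i = In-· M (β∈ i) γ∈
    β∈′ (suc _) i = β∈ i
    b∈′ : ∀ s i → In M (twistedb β b γ δ ε s i)
    b∈′ zero    i = In-· M (b∈ i) δ∈
    b∈′ (suc _) i = In-· M (b∈ i) ε∈
    factor-0 : δ · F 0 γ + ε ≡ 1#
    factor-0 = begin
      δ · F 0 γ + - F N γ · δ   ≡⟨ cong (λ z → δ · z + ε) (F-0 γ) ⟩
      δ · γ + - F N γ · δ       ≡⟨ cong (_+ ε) (*-comm δ γ) ⟩
      γ · δ + - F N γ · δ       ≡⟨ distribʳ δ γ (- F N γ) ⟨
      Δ · δ                     ≡⟨ inv-r Δ Δ≢0 ⟩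
      1#                        ∎
    factor-N : δ · F N γ + ε ≡ 0#
    factor-N = begin
      δ · F N γ + - F N γ · δ   ≡⟨ cong (_+ ε) (*-comm δ (F N γ)) ⟩
      F N γ · δ + - F N γ · δ   ≡⟨ distribʳ δ _ _ ⟨
      (F N γ + - F N γ) · δ     ≡⟨ cong (_· δ) (-‿inverseʳ _) ⟩
      0# · δ                    ≡⟨ zeroˡ δ ⟩
      0#                        ∎
    vanish : ∀ {u} → 0 < u → u < N ⊎ u ≡ N → evaluate β b u · (δ · F u γ + ε) ≡ 0#
    vanish {u} 0<u (inj₁ u<N) = trans (cong (_· (δ · F u γ + ε)) (dual-≢0 0<u u<N)) (zeroˡ _)
    vanish     0<u (inj₂ refl) = trans (cong (evaluate β b N ·_) factor-N) (zeroʳ _)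

  dualFamily : ∀ M → (∀ u → 0 < u → u < M → Σ Carrier λ γ → In M γ × F u γ ≢ γ) →
    ∀ N → N ≤ M → DualFamily M N
  dualFamily M separate zero N≤M = record
    { r = 1 ; β = λ _ → 1# ; b = λ _ → 1# ; β∈ = λ _ → F-1# M ; b∈ = λ _ → F-1# M
    ; dual-0 = trans (+-identityʳ _) (trans (*-identityˡ _) (F-1# 0)) ; dual-≢0 = λ _ () }
  -- No u satisfies 0 < u < 1, so the one-point family is kept; no factor could be formed here, as
  -- F⁰ moves nothing.
  dualFamily M separate (suc zero) N≤M = record
    { DualFamily (dualFamily M separate zero z≤n) ; dual-≢0 = λ { 0<u (s≤s z≤n) → contradiction 0<u λ () } }
  dualFamily M separate (suc (suc n)) N≤M =
    let γ , γ∈ , γ-moved = separate (suc n) z<s N≤M in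
    extendDual z<s γ∈ γ-moved (dualFamily M separate (suc n) (ℕₚ.<⇒≤ N≤M))

  fullDual : DualFamily d d
  fullDual = dualFamily d separate d ℕₚ.≤-refl
    where
    separate : ∀ u → 0 < u → u < d → Σ Carrier λ γ → In d γ × F u γ ≢ γ
    separate u 0<u u<d = proj₁ nf , F-full _ , proj₂ nf
      where
      nf = nonfixed (ℕₚ.≤-trans 2≤q (subst (_≤ q ^ u) (ℕₚ.^-identityʳ q) (ℕₚ.^-monoʳ-≤ q 0<u)))
             (subst (q ^ u <_) (sym size≡) (ℕₚ.^-monoʳ-< q 2≤q u<d))

  module _ (h m : ℕ) (d≡hm : d ≡ h * m) (0<h : 0 < h) where
    open DualFamily fullDual

    private
      T : Carrier → Carrier
      T = partialTrace h m

    -- Composed with `T`, the power Fᵘ becomes the sum of the powers F^(u + jm). For u < m these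
    -- exponents stay below d, so the family for d sees only the exponent 0, which occurs exactly
    -- when u = 0.
    evaluate-T : ∀ u → sum (λ i → b i · F u (T (β i))) ≡ sum {h} (λ j → evaluate β b (u Nat.+ toℕ j * m))
    evaluate-T u = begin
      sum (λ i → b i · F u (T (β i)))
        ≡⟨ sum-cong-≗ (λ i → trans (cong (b i ·_) (trans (F-sum u {h} _) (sum-cong-≗ {h} (λ j → F-∘ u (toℕ j * m) (β i))))) (*-distribˡ-sum {h} (b i) _)) ⟩
      sum (λ i → sum {h} (λ j → b i · F (u Nat.+ toℕ j * m) (β i)))
        ≡⟨ ∑-comm (λ i (j : Fin h) → b i · F (u Nat.+ toℕ j * m) (β i)) ⟩
      sum {h} (λ j → evaluate β b (u Nat.+ toℕ j * m)) ∎

    index<d : ∀ {u} (j : Fin h) → u < m → u Nat.+ toℕ j * m < d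
    index<d j u<m = subst (_ <_) (sym d≡hm) (ℕₚ.<-≤-trans (ℕₚ.+-monoˡ-< (toℕ j * m) u<m) (ℕₚ.*-monoˡ-≤ m (toℕ<n j)))

    evaluate-T-0 : 0 < m → sum (λ i → b i · F 0 (T (β i))) ≡ 1#
    evaluate-T-0 0<m = trans (evaluate-T 0) (go h 0<h (λ j → index<d j 0<m))
      where
      go : ∀ h → 0 < h → (∀ (j : Fin h) → toℕ j * m < d) → sum {h} (λ j → evaluate β b (toℕ j * m)) ≡ 1#
      go (suc h) _ bound = trans
        (sum-single {suc h} zero (λ j → evaluate β b (toℕ j * m))
          λ { zero j≢0 → contradiction refl j≢0 ; (suc j) _ → dual-≢0 (ℕₚ.<-≤-trans 0<m (ℕₚ.m≤m+n m _)) (bound (suc j)) })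
        dual-0

    evaluate-T-≢0 : ∀ {u} → 0 < u → u < m → sum (λ i → b i · F u (T (β i))) ≡ 0#
    evaluate-T-≢0 {u} 0<u u<m = trans (evaluate-T u)
      (sum-≈ε {h} _ (λ j → dual-≢0 (ℕₚ.<-≤-trans 0<u (ℕₚ.m≤m+n u _)) (index<d j u<m)))

    -- If Fᵘ were trivial on F_{q^m}, the images of the family for d under the partial trace
    -- K → F_{q^m} would give 0 = 1.
    subfield-separate : ∀ u → 0 < u → u < m → Σ Carrier λ γ → In m γ × F u γ ≢ γ
    subfield-separate u 0<u u<m with any? (λ i → ¬? (F u (T (β i)) ≟ T (β i)))
    ... | yes (i , nf) = T (β i) , In-partialTrace h m (β i) (subst (λ j → In j (β i)) d≡hm (β∈ i)) , nf
    ... | no  none     = contradiction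
      (begin
        0#                              ≡⟨ evaluate-T-≢0 0<u u<m ⟨
        sum (λ i → b i · F u (T (β i))) ≡⟨ sum-cong-≗ (λ i → cong (b i ·_) (trans (decidable-stable (_ ≟ _) (λ nf → none (i , nf))) (sym (F-0 _)))) ⟩
        sum (λ i → b i · F 0 (T (β i))) ≡⟨ evaluate-T-0 (ℕₚ.<-trans 0<u u<m) ⟩
        1#                              ∎)
      0≢1

  subfieldDual : 0 < d → ∀ {m} → m ∣ d → DualFamily m m
  subfieldDual 0<d {m} (divides zero d≡)      = contradiction d≡ (ℕₚ.m<n⇒n≢0 0<d)
  subfieldDual 0<d {m} (divides h@(suc _) d≡) = dualFamily m (subfield-separate h m d≡ z<s) m ℕₚ.≤-refl

-- Orthogonality relations and the bilinear forms.

module BilinearForms (K : FiniteField) (p s : ℕ) (p-prime : Prime p) (1≤s : 1 ≤ s)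
                     (m n k : ℕ) (0<m : 0 < m) (0<n : 0 < n) (k⊥m : Coprime k m)
                     (size≡ : FiniteField.size K ≡ (p ^ s) ^ lcm m n) where
  open FiniteField K renaming (_*_ to _·_)
  open FiniteFieldTheory K
  open Frobenius K p s (lcm m n) p-prime 1≤s size≡
  open Over q
  open ≡-Reasoning

  d e : ℕ
  d = lcm m n
  e = gcd m n

  instance
    m-nonZero : NonZero m
    m-nonZero = >-nonZero 0<m
    n-nonZero : NonZero n
    n-nonZero = >-nonZero 0<n

  0<d : 0 < d
  0<d = ℕₚ.n≢0⇒n>0 λ d≡0 → ℕₚ.m<n⇒n≢0 (ℕₚ.*-mono-< 0<m 0<n)
    (trans (sym (gcd*lcm m n)) (trans (cong (e *_) d≡0) (ℕₚ.*-zeroʳ e)))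

  module Orthogonality {M} .{{_ : NonZero M}} (family : DualFamily M M) where
    open DualFamily family

    pairing : ℕ → ℕ → Carrier
    pairing v w = sum (λ i → F v (b i) · F w (β i))

    -- Pulling Fᵛ out of the sum leaves the family at the exponent w - v modulo `M`. Hence the
    -- pairing is 1 or 0 according to whether v and w agree modulo `M`.
    pairing-congruent : ∀ {v w u} → Congruent M w (v Nat.+ u) → pairing v w ≡ F v (evaluate β b u)
    pairing-congruent {v} {w} {u} w≡v+u = begin
      sum (λ i → F v (b i) · F w (β i))         ≡⟨ sum-cong-≗ (λ i → cong (F v (b i) ·_) (trans (F-congruent {M} (β∈ i) w≡v+u) (sym (F-∘ v u (β i))))) ⟩
      sum (λ i → F v (b i) · F v (F u (β i)))   ≡⟨ sum-cong-≗ (λ i → F-· v (b i) (F u (β i))) ⟨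
      sum (λ i → F v (b i · F u (β i)))         ≡⟨ F-sum v (λ i → b i · F u (β i)) ⟨
      F v (evaluate β b u)                      ∎

    pairing-≡1 : ∀ {v w} → Congruent M w v → pairing v w ≡ 1#
    pairing-≡1 {v} {w} w≡v = trans
      (pairing-congruent {v} {w} {0} (subst (Congruent M w) (sym (ℕₚ.+-identityʳ v)) w≡v))
      (trans (cong (F v) dual-0) (F-1# v))

    pairing-≡0 : ∀ v w → Congruent M w v ⊎ pairing v w ≡ 0#
    pairing-≡0 v w with congruent-difference M v w
    ... | zero  , _   , w≡v   = inj₁ (subst (Congruent M w) (ℕₚ.+-identityʳ v) w≡v)
    ... | suc u , u<M , w≡v+u = inj₂ (trans (pairing-congruent {v} {w} {suc u} w≡v+u)
                                  (trans (cong (F v) (dual-≢0 z<s u<M)) (F-0# v)))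

    -- The dual-basis expansion without a basis: exchanging the sums gives the terms
    -- `evaluate β b u · F u x`, and only u = 0 survives.
    reconstruct : ∀ {x} → In M x → x ≡ sum (λ i → trace M (β i · x) · b i)
    reconstruct {x} x∈ = sym (begin
      sum (λ i → trace M (β i · x) · b i)
        ≡⟨ sum-cong-≗ (λ i → trans (*-distribʳ-sum {M} (b i) _) (sum-cong-≗ {M} (λ u →
             trans (cong (_· b i) (F-· (toℕ u) (β i) x))
               (solve 3 (λ y z b → y :* z :* b := b :* y :* z) refl (F (toℕ u) (β i)) (F (toℕ u) x) (b i))))) ⟩
      sum (λ i → sum {M} (λ u → b i · F (toℕ u) (β i) · F (toℕ u) x))
        ≡⟨ ∑-comm (λ i (u : Fin M) → b i · F (toℕ u) (β i) · F (toℕ u) x) ⟩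
      sum {M} (λ u → sum (λ i → b i · F (toℕ u) (β i) · F (toℕ u) x))
        ≡⟨ sum-cong-≗ {M} (λ u → *-distribʳ-sum (F (toℕ u) x) (λ i → b i · F (toℕ u) (β i))) ⟨
      sum {M} (λ u → evaluate β b (toℕ u) · F (toℕ u) x)
        ≡⟨ first M 0<M dual-≢0 ⟩
      x ∎)
      where
      0<M : 0 < M
      0<M = Nat.>-nonZero⁻¹ M
      -- The length is generalised so that it can be matched as a successor, which gives access to
      -- the index `zero`.
      first : ∀ N → 0 < N → (∀ {u} → 0 < u → u < N → evaluate β b u ≡ 0#) →
        sum {N} (λ u → evaluate β b (toℕ u) · F (toℕ u) x) ≡ x
      first (suc N) _ vanish = trans
        (sum-single {suc N} zero (λ u → evaluate β b (toℕ u) · F (toℕ u) x)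
          λ { zero u≢0 → contradiction refl u≢0
            ; (suc u) _ → trans (cong (_· F (suc (toℕ u)) x) (vanish z<s (toℕ<n (suc u)))) (zeroˡ _) })
        (trans (cong₂ _·_ dual-0 (F-0 x)) (*-identityˡ x))

  module _ {r r′ : ℕ} where
    sum-weighted : (w : Fin r → Fin r′ → Carrier) → ∀ {N} (φ : Fin N → Fin r → Fin r′ → Carrier) →
      sum (λ i → sum (λ l → w i l · sum (λ j → φ j i l))) ≡ sum (λ j → sum (λ i → sum (λ l → w i l · φ j i l)))
    sum-weighted w φ = begin
      sum (λ i → sum (λ l → w i l · sum (λ j → φ j i l)))
        ≡⟨ sum-cong-≗ (λ i → sum-cong-≗ (λ l → *-distribˡ-sum (w i l) (λ j → φ j i l))) ⟩
      sum (λ i → sum (λ l → sum (λ j → w i l · φ j i l)))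
        ≡⟨ sum-cong-≗ (λ i → ∑-comm (λ l j → w i l · φ j i l)) ⟩
      sum (λ i → sum (λ j → sum (λ l → w i l · φ j i l)))
        ≡⟨ ∑-comm (λ i j → sum (λ l → w i l · φ j i l)) ⟩
      sum (λ j → sum (λ i → sum (λ l → w i l · φ j i l))) ∎

    sum-product : (f : Fin r → Carrier) (g : Fin r′ → Carrier) → sum f · sum g ≡ sum (λ i → sum (λ l → f i · g l))
    sum-product f g = trans (*-distribʳ-sum (sum g) f) (sum-cong-≗ (λ i → *-distribˡ-sum (f i) g))

  fkaj-trace : ∀ a j x x′ → fkaj d k a j x x′ ≡ trace d (a · x · F (k * j) x′)
  fkaj-trace a j x x′ = Tr≡trace _

  -- The exponents (t, t + k j) of these monomials are the pairs that `index-injective` separates.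
  fkaj-expand : ∀ a j x x′ → fkaj d k a j x x′ ≡ sum {d} (λ t → F (toℕ t) a · (F (toℕ t) x · F (toℕ t Nat.+ k * j) x′))
  fkaj-expand a j x x′ = trans (fkaj-trace a j x x′) (sum-cong-≗ {d} λ t → begin
    F (toℕ t) (a · x · F (k * j) x′)                          ≡⟨ trans (F-· (toℕ t) (a · x) _) (cong₂ _·_ (F-· (toℕ t) a x) (F-∘ (toℕ t) (k * j) x′)) ⟩
    F (toℕ t) a · F (toℕ t) x · F (toℕ t Nat.+ k * j) x′      ≡⟨ *-assoc _ _ _ ⟩
    F (toℕ t) a · (F (toℕ t) x · F (toℕ t Nat.+ k * j) x′)    ∎)

  fkaj-bilinear : ∀ a j → IsBilinear m n (fkaj d k a j)
  fkaj-bilinear a j =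
      (λ x x′ _ _ → subst (In 1) (sym (fkaj-trace a j x x′)) (trace-∈ {d} (F-full _)))
    , (λ x y x′ _ _ _ → additive x x′ y x′ (x + y) x′ (trans (cong (_· F (k * j) x′) (distribˡ a x y)) (distribʳ _ _ _)))
    , (λ c x x′ c∈ _ _ → homogeneous c∈ x x′ (c · x) x′
         (solve 4 (λ a c x y → a :* (c :* x) :* y := c :* (a :* x :* y)) refl a c x (F (k * j) x′)))
    , (λ x x′ y′ _ _ _ → additive x x′ x y′ x (x′ + y′) (trans (cong (a · x ·_) (F-+ (k * j) x′ y′)) (distribˡ _ _ _)))
    , (λ c x x′ c∈ _ _ → homogeneous c∈ x x′ x (c · x′)
         (trans (cong (a · x ·_) (trans (F-· (k * j) c x′) (cong (_· F (k * j) x′) (F-scalar c∈ (k * j)))))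
           (solve 3 (λ z c y → z :* (c :* y) := c :* (z :* y)) refl (a · x) c (F (k * j) x′))))
    where
    additive : ∀ x x′ y y′ z z′ → a · z · F (k * j) z′ ≡ a · x · F (k * j) x′ + a · y · F (k * j) y′ →
      fkaj d k a j z z′ ≡ fkaj d k a j x x′ + fkaj d k a j y y′
    additive x x′ y y′ z z′ eq = begin
      fkaj d k a j z z′                                                   ≡⟨ trans (fkaj-trace a j z z′) (cong (trace d) eq) ⟩
      trace d (a · x · F (k * j) x′ + a · y · F (k * j) y′)               ≡⟨ trace-+ d _ _ ⟩
      trace d (a · x · F (k * j) x′) + trace d (a · y · F (k * j) y′)     ≡⟨ cong₂ _+_ (fkaj-trace a j x x′) (fkaj-trace a j y y′) ⟨
      fkaj d k a j x x′ + fkaj d k a j y y′                               ∎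
    homogeneous : ∀ {c} → In 1 c → ∀ x x′ y y′ → a · y · F (k * j) y′ ≡ c · (a · x · F (k * j) x′) →
      fkaj d k a j y y′ ≡ c · fkaj d k a j x x′
    homogeneous {c} c∈ x x′ y y′ eq = begin
      fkaj d k a j y y′                        ≡⟨ trans (fkaj-trace a j y y′) (cong (trace d) eq) ⟩
      trace d (c · (a · x · F (k * j) x′))     ≡⟨ trace-scale d _ c∈ ⟩
      c · trace d (a · x · F (k * j) x′)       ≡⟨ cong (c ·_) (fkaj-trace a j x x′) ⟨
      c · fkaj d k a j x x′                    ∎

  reindex : Fin e × Fin d → Fin m × Fin n
  reindex (j , t) = fromℕ< (m%n<n (toℕ t) m) , fromℕ< (m%n<n (toℕ t Nat.+ k * toℕ j) n)

  reindex-injective : Injective _≡_ _≡_ reindex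
  reindex-injective {j , t} {j′ , t′} eq = cong₂ _,_ (toℕ-injective (proj₁ indices)) (toℕ-injective (proj₂ indices))
    where
    residue : ∀ {N x y} .{{_ : NonZero N}} → fromℕ< (m%n<n x N) ≡ fromℕ< (m%n<n y N) → Congruent N x y
    residue {N} {x} {y} eq = %≡⇒congruent (trans (sym (toℕ-fromℕ< (m%n<n x N))) (trans (cong toℕ eq) (toℕ-fromℕ< (m%n<n y N))))
    indices : toℕ j ≡ toℕ j′ × toℕ t ≡ toℕ t′
    indices = index-injective {m} {n} {k} k⊥m (toℕ<n j) (toℕ<n j′) (toℕ<n t) (toℕ<n t′)
      (residue (cong proj₁ eq)) (residue (cong proj₂ eq))

  -- The product is a sum of Fᵘ(y) Fᵛ(z) over all u < m, v < n. As e d = m n, the substitution u =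
  -- t, v = t + k j runs through these pairs once, and the terms with a fixed j form one trace from
  -- F_{q^d}.
  trace-product : ∀ {y z} → In m y → In n z →
    trace m y · trace n z ≡ sum {e} (λ j → trace d (y · F (k * toℕ j) z))
  trace-product {y} {z} y∈ z∈ = begin
    trace m y · trace n z
      ≡⟨ sum-product {m} {n} _ _ ⟩
    sum {m} (λ u → sum {n} (λ v → F (toℕ u) y · F (toℕ v) z))
      ≡⟨ sum-reindex {e} {d} {m} {n} (gcd*lcm m n) reindex reindex-injective (λ u v → F (toℕ u) y · F (toℕ v) z) ⟩
    sum {e} (λ j → sum {d} (λ t → uncurry (λ u v → F (toℕ u) y · F (toℕ v) z) (reindex (j , t))))
      ≡⟨ sum-cong-≗ {e} (λ j → sum-cong-≗ {d} (λ t → entry j t)) ⟩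
    sum {e} (λ j → trace d (y · F (k * toℕ j) z)) ∎
    where
    residue : ∀ {N x} i .{{_ : NonZero N}} → In N x → F (toℕ (fromℕ< (m%n<n i N))) x ≡ F i x
    residue {N} {x} i x∈ = trans (cong (λ j → F j x) (toℕ-fromℕ< (m%n<n i N))) (F-congruent {N} x∈ (congruent-% N i))
    entry : ∀ j t → uncurry (λ u v → F (toℕ u) y · F (toℕ v) z) (reindex (j , t)) ≡ F (toℕ t) (y · F (k * toℕ j) z)
    entry j t = begin
      _                                                  ≡⟨ cong₂ _·_ (residue {m} (toℕ t) y∈) (residue {n} (toℕ t Nat.+ k * toℕ j) z∈) ⟩
      F (toℕ t) y · F (toℕ t Nat.+ k * toℕ j) z          ≡⟨ cong (F (toℕ t) y ·_) (F-∘ (toℕ t) (k * toℕ j) z) ⟨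
      F (toℕ t) y · F (toℕ t) (F (k * toℕ j) z)          ≡⟨ F-· (toℕ t) y _ ⟨
      F (toℕ t) (y · F (k * toℕ j) z)                    ∎

  -- Recovering and constructing the coefficients.

  module Decomposition (dual-m : DualFamily m m) (dual-n : DualFamily n n) where
    open DualFamily dual-m
    open DualFamily dual-n using () renaming (r to r′; β to γ; b to c; β∈ to γ∈; b∈ to c∈)
    module Oₘ = Orthogonality dual-m
    module Oₙ = Orthogonality dual-n

    -- The weights turn a monomial Fᵗ(x) F^(t + k j)(x′) into a pairing of 0 with t times a pairing
    -- of k j₀ with t + k j; this survives only at t = 0, j = j₀. The factor `F 0` is kept to match
    -- the shape of `pairing 0`.
    extract : Fin e → (Carrier → Carrier → Carrier) → Carrier
    extract j₀ f = sum (λ i → sum (λ l → F 0 (b i) · F (k * toℕ j₀) (c l) · f (β i) (γ l)))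

    extract-sumForms : ∀ j₀ (a : Fin e → Carrier) → extract j₀ (sumForms d k e a) ≡ a j₀
    extract-sumForms j₀ a = begin
      extract j₀ (sumForms d k e a)
        ≡⟨ sum-cong-≗ (λ i → sum-cong-≗ (λ l → cong (w i l ·_) (trans (sumFin≡sum {e} _)
             (sum-cong-≗ {e} (λ j → fkaj-expand (a j) (toℕ j) (β i) (γ l)))))) ⟩
      sum (λ i → sum (λ l → w i l · sum (λ j → sum (λ t → φ j t i l))))
        ≡⟨ sum-weighted w (λ j i l → sum (λ t → φ j t i l)) ⟩
      sum (λ j → sum (λ i → sum (λ l → w i l · sum (λ t → φ j t i l))))
        ≡⟨ sum-cong-≗ {e} (λ j → trans (sum-weighted w (φ j)) (sum-cong-≗ {d} (λ t → factor (F (toℕ t) (a j)) (toℕ t) (toℕ t Nat.+ k * toℕ j)))) ⟩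
      sum (λ j → sum (λ t → term j t))
        ≡⟨ sum-single {e} j₀ (λ j → sum (λ t → term j t)) (λ j j≢j₀ → sum-≈ε {d} (term j) (λ t → vanish j t (λ j≡ _ → j≢j₀ j≡))) ⟩
      sum (λ t → term j₀ t)
        ≡⟨ first d 0<d (λ t 0<t t<d → vanish-at j₀ t t<d (λ _ t≡0 → ℕₚ.m<n⇒n≢0 0<t t≡0)) ⟩
      a j₀ ∎
      where
      v : ℕ
      v = k * toℕ j₀
      w : Fin r → Fin r′ → Carrier
      w i l = F 0 (b i) · F v (c l)
      φ : Fin e → Fin d → Fin r → Fin r′ → Carrier
      φ j t i l = F (toℕ t) (a j) · (F (toℕ t) (β i) · F (toℕ t Nat.+ k * toℕ j) (γ l))
      termAt : Fin e → ℕ → Carrier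
      termAt j t = F t (a j) · (Oₘ.pairing 0 t · Oₙ.pairing v (t Nat.+ k * toℕ j))
      term : Fin e → Fin d → Carrier
      term j t = termAt j (toℕ t)

      factor : ∀ A t u → sum (λ i → sum (λ l → w i l · (A · (F t (β i) · F u (γ l)))))
                       ≡ A · (Oₘ.pairing 0 t · Oₙ.pairing v u)
      factor A t u = begin
        sum (λ i → sum (λ l → w i l · (A · (F t (β i) · F u (γ l)))))
          ≡⟨ sum-cong-≗ (λ i → trans (sum-cong-≗ (λ l → solve 5 (λ b c A x y → b :* c :* (A :* (x :* y)) := A :* (b :* x :* (c :* y))) refl (F 0 (b i)) (F v (c l)) A (F t (β i)) (F u (γ l))))
               (sym (*-distribˡ-sum A (λ l → F 0 (b i) · F t (β i) · (F v (c l) · F u (γ l)))))) ⟩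
        sum (λ i → A · sum (λ l → F 0 (b i) · F t (β i) · (F v (c l) · F u (γ l))))
          ≡⟨ *-distribˡ-sum A (λ i → sum (λ l → F 0 (b i) · F t (β i) · (F v (c l) · F u (γ l)))) ⟨
        A · sum (λ i → sum (λ l → F 0 (b i) · F t (β i) · (F v (c l) · F u (γ l))))
          ≡⟨ cong (A ·_) (sum-product (λ i → F 0 (b i) · F t (β i)) (λ l → F v (c l) · F u (γ l))) ⟨
        A · (Oₘ.pairing 0 t · Oₙ.pairing v u) ∎

      vanish-at : ∀ j t → t < d → (j ≡ j₀ → ¬ t ≡ 0) → termAt j t ≡ 0#
      vanish-at j t t<d off = cases (Oₘ.pairing-≡0 0 t) (Oₙ.pairing-≡0 v u)
        where
        u : ℕ
        u = t Nat.+ k * toℕ j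
        cases : Congruent m t 0 ⊎ Oₘ.pairing 0 t ≡ 0# → Congruent n u v ⊎ Oₙ.pairing v u ≡ 0# → termAt j t ≡ 0#
        cases (inj₂ zero₁) _ = trans (cong (λ z → F t (a j) · (z · Oₙ.pairing v u)) zero₁)
          (trans (cong (F t (a j) ·_) (zeroˡ (Oₙ.pairing v u))) (zeroʳ (F t (a j))))
        cases (inj₁ _) (inj₂ zero₂) = trans (cong (λ z → F t (a j) · (Oₘ.pairing 0 t · z)) zero₂)
          (trans (cong (F t (a j) ·_) (zeroʳ (Oₘ.pairing 0 t))) (zeroʳ (F t (a j))))
        -- Both pairings can be nonzero only if (j, t) and (j₀, 0) have the same image under the
        -- index map, which `off` excludes.
        cases (inj₁ t≡0) (inj₁ u≡v) = contradiction (proj₂ indices) (off (toℕ-injective (proj₁ indices)))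
          where
          indices : toℕ j ≡ toℕ j₀ × t ≡ 0
          indices = index-injective {m} {n} {k} k⊥m (toℕ<n j) (toℕ<n j₀) t<d 0<d t≡0 u≡v

      vanish : ∀ j t → (j ≡ j₀ → ¬ toℕ t ≡ 0) → term j t ≡ 0#
      vanish j t off = vanish-at j (toℕ t) (toℕ<n t) off

      first : ∀ D → 0 < D → (∀ t → 0 < t → t < D → termAt j₀ t ≡ 0#) → sum {D} (λ t → termAt j₀ (toℕ t)) ≡ a j₀
      first (suc D) _ zeros = begin
        sum {suc D} (λ t → termAt j₀ (toℕ t))
          ≡⟨ sum-single {suc D} zero (λ t → termAt j₀ (toℕ t)) (λ { zero t≢0 → contradiction refl t≢0 ; (suc t) _ → zeros (suc (toℕ t)) z<s (toℕ<n (suc t)) }) ⟩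
        F 0 (a j₀) · (Oₘ.pairing 0 0 · Oₙ.pairing v v)
          ≡⟨ cong₂ _·_ (F-0 (a j₀)) (cong₂ _·_ (Oₘ.pairing-≡1 {0} {0} (0 , 0 , refl)) (Oₙ.pairing-≡1 {v} {v} (0 , 0 , refl))) ⟩
        a j₀ · (1# · 1#)
          ≡⟨ trans (cong (a j₀ ·_) (*-identityˡ 1#)) (*-identityʳ _) ⟩
        a j₀ ∎

    -- `extract` samples a form only at points of F_{q^m} × F_{q^n}, so equality there is enough.
    sumForms-injective : ∀ (a a′ : Fin e → Carrier) → FormEq m n (sumForms d k e a) (sumForms d k e a′) → ∀ j → a j ≡ a′ j
    sumForms-injective a a′ eq j = begin
      a j                               ≡⟨ extract-sumForms j a ⟨
      extract j (sumForms d k e a)      ≡⟨ sum-cong-≗ (λ i → sum-cong-≗ (λ l → cong (F 0 (b i) · F (k * toℕ j) (c l) ·_) (eq (β i) (γ l) (β∈ i) (γ∈ l)))) ⟩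
      extract j (sumForms d k e a′)     ≡⟨ extract-sumForms j a′ ⟩
      a′ j                              ∎

    -- Expanding both arguments gives f(x, x′) as the sum of f(bᵢ, cₗ) Tr(βᵢ x) Tr(γₗ x′). By
    -- `trace-product` the j-th part is a trace in which x F^(k j)(x′) has this factor.
    coefficients : (Carrier → Carrier → Carrier) → Fin e → Carrier
    coefficients f j = sum (λ i → sum (λ l → f (b i) (c l) · (β i · F (k * toℕ j) (γ l))))

    sumForms-coefficients : ∀ f → IsBilinear m n f → FormEq m n f (sumForms d k e (coefficients f))
    sumForms-coefficients f (f∈ , +ˡ , ·ˡ , +ʳ , ·ʳ) x x′ x∈ x′∈ = begin
      f x x′
        ≡⟨ cong₂ f (Oₘ.reconstruct x∈) (Oₙ.reconstruct x′∈) ⟩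
      f (sum X) (sum X′)
        ≡⟨ additive-sum m (λ y → f y (sum X′)) (λ y z y∈ z∈ → +ˡ y z (sum X′) y∈ z∈ (In-sum n X′ X′∈)) X X∈ ⟩
      sum (λ i → f (X i) (sum X′))
        ≡⟨ sum-cong-≗ (λ i → additive-sum n (f (X i)) (λ y z → +ʳ (X i) y z (X∈ i)) X′ X′∈) ⟩
      sum (λ i → sum (λ l → f (X i) (X′ l)))
        ≡⟨ sum-cong-≗ (λ i → sum-cong-≗ (λ l → scalars i l)) ⟩
      sum (λ i → sum (λ l → w i l · (trace m (β i · x) · trace n (γ l · x′))))
        ≡⟨ sum-cong-≗ (λ i → sum-cong-≗ (λ l → cong (w i l ·_) (trace-product (In-· m (β∈ i) x∈) (In-· n (γ∈ l) x′∈)))) ⟩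
      sum (λ i → sum (λ l → w i l · sum {e} (λ j → ψ j i l)))
        ≡⟨ sum-weighted w ψ ⟩
      sum {e} (λ j → sum (λ i → sum (λ l → w i l · ψ j i l)))
        ≡⟨ sum-cong-≗ {e} form ⟨
      sum {e} (λ j → fkaj d k (coefficients f j) (toℕ j) x x′)
        ≡⟨ sumFin≡sum {e} _ ⟨
      sumForms d k e (coefficients f) x x′ ∎
      where
      X : Fin r → Carrier
      X i = trace m (β i · x) · b i
      X′ : Fin r′ → Carrier
      X′ l = trace n (γ l · x′) · c l
      w : Fin r → Fin r′ → Carrier
      w i l = f (b i) (c l)
      ψ : Fin e → Fin r → Fin r′ → Carrier
      ψ j i l = trace d (β i · x · F (k * toℕ j) (γ l · x′))
      τ∈ : ∀ i → In 1 (trace m (β i · x))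
      τ∈ i = trace-∈ {m} (In-· m (β∈ i) x∈)
      τ′∈ : ∀ l → In 1 (trace n (γ l · x′))
      τ′∈ l = trace-∈ {n} (In-· n (γ∈ l) x′∈)
      scalar∈ : ∀ N {c y} → In 1 c → In N y → In N (c · y)
      scalar∈ N c∈ y∈ = In-· N (F-scalar c∈ N) y∈
      X∈ : ∀ i → In m (X i)
      X∈ i = scalar∈ m (τ∈ i) (b∈ i)
      X′∈ : ∀ l → In n (X′ l)
      X′∈ l = scalar∈ n (τ′∈ l) (c∈ l)
      scalars : ∀ i l → f (X i) (X′ l) ≡ w i l · (trace m (β i · x) · trace n (γ l · x′))
      scalars i l = begin
        f (X i) (X′ l)
          ≡⟨ ·ˡ _ (b i) (X′ l) (τ∈ i) (b∈ i) (X′∈ l) ⟩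
        trace m (β i · x) · f (b i) (X′ l)
          ≡⟨ cong (trace m (β i · x) ·_) (·ʳ _ (b i) (c l) (τ′∈ l) (b∈ i) (c∈ l)) ⟩
        trace m (β i · x) · (trace n (γ l · x′) · w i l)
          ≡⟨ solve 3 (λ t t′ w → t :* (t′ :* w) := w :* (t :* t′)) refl (trace m (β i · x)) (trace n (γ l · x′)) (w i l) ⟩
        w i l · (trace m (β i · x) · trace n (γ l · x′)) ∎
      trace-additive : ∀ {N} (g : Fin N → Carrier) → trace d (sum g) ≡ sum (λ i → trace d (g i))
      trace-additive g = additive-sum d (trace d) (λ y z _ _ → trace-+ d y z) g (λ _ → F-full _)
      form : ∀ j → fkaj d k (coefficients f j) (toℕ j) x x′ ≡ sum (λ i → sum (λ l → w i l · ψ j i l))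
      form j = begin
        fkaj d k (coefficients f j) (toℕ j) x x′
          ≡⟨ fkaj-trace (coefficients f j) (toℕ j) x x′ ⟩
        trace d (coefficients f j · x · Fx′)
          ≡⟨ cong (trace d) (trans (*-assoc _ _ _) (trans (*-distribʳ-sum (x · Fx′) A) (sum-cong-≗ (λ i → *-distribʳ-sum (x · Fx′) (B i))))) ⟩
        trace d (sum (λ i → sum (λ l → B i l · (x · Fx′))))
          ≡⟨ trans (trace-additive (λ i → sum (λ l → B i l · (x · Fx′)))) (sum-cong-≗ (λ i → trace-additive (λ l → B i l · (x · Fx′)))) ⟩
        sum (λ i → sum (λ l → trace d (B i l · (x · Fx′))))
          -- The values `w i l` lie in F_q because `f` does, so they pass through the trace.
          ≡⟨ sum-cong-≗ (λ i → sum-cong-≗ (λ l → trans (cong (trace d) (regroup i l)) (trace-scale d _ (f∈ (b i) (c l) (b∈ i) (c∈ l))))) ⟩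
        sum (λ i → sum (λ l → w i l · ψ j i l)) ∎
        where
        Fx′ : Carrier
        Fx′ = F (k * toℕ j) x′
        B : Fin r → Fin r′ → Carrier
        B i l = w i l · (β i · F (k * toℕ j) (γ l))
        A : Fin r → Carrier
        A i = sum (B i)
        regroup : ∀ i l → B i l · (x · Fx′) ≡ w i l · (β i · x · F (k * toℕ j) (γ l · x′))
        regroup i l = trans
          (solve 5 (λ w β g x x′ → w :* (β :* g) :* (x :* x′) := w :* (β :* x :* (g :* x′))) refl (w i l) (β i) (F (k * toℕ j) (γ l)) x Fx′)
          (cong (λ z → w i l · (β i · x · z)) (sym (F-· (k * toℕ j) (γ l) x′)))

  open Decomposition (subfieldDual 0<d (m∣lcm[m,n] m n)) (subfieldDual 0<d (n∣lcm[m,n] m n)) public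
    using (sumForms-injective; coefficients; sumForms-coefficients)

theorem2p5 : (p s : ℕ) → Prime p → 1 ≤ s →
  (m n k : ℕ) → 2 ≤ m → 2 ≤ n → 1 ≤ k → Coprime k m → Coprime k n →
  (K : FiniteField) → FiniteField.size K ≡ (p ^ s) ^ lcm m n →
  let open FieldOps K
      open Over (p ^ s)
      e = gcd m n
      d = lcm m n
  in ((a : FiniteField.Carrier K) (j : ℕ) → j < e → IsBilinear m n (fkaj d k a j))
   × ((f : FiniteField.Carrier K → FiniteField.Carrier K → FiniteField.Carrier K) →
        IsBilinear m n f → Σ (Fin e → FiniteField.Carrier K) (λ a → FormEq m n f (sumForms d k e a)))
   × ((a b : Fin e → FiniteField.Carrier K) → FormEq m n (sumForms d k e a) (sumForms d k e b) →
        (j : Fin e) → FormEq m n (fkaj d k (a j) (toℕ j)) (fkaj d k (b j) (toℕ j)))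
theorem2p5 p s p-prime 1≤s m n k 2≤m 2≤n _ k⊥m _ K size≡ =
    (λ a j _ → fkaj-bilinear a j)
  , (λ f f-bilinear → coefficients f , sumForms-coefficients f f-bilinear)
  -- Directness is uniqueness of the components; here even the parameters of the components
  -- coincide.
  , (λ a b eq j x x′ _ _ → cong (λ z → fkaj (lcm m n) k z (toℕ j) x x′) (sumForms-injective a b eq j))
  where
  open FieldOps.Over K (p ^ s) using (fkaj)
  open BilinearForms K p s p-prime 1≤s m n k (ℕₚ.<⇒≤ 2≤m) (ℕₚ.<⇒≤ 2≤n) k⊥m size≡
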